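{- Each of the following six "generalised bunkbed statements" is false; that is, for each of the six percolation models $\mathcal{E}$ listed in the context there exist a structure $Q$ of the appropriate kind (together with the required auxiliary sets $T$, and $F$ where applicable) and vertices $u,v\in V(Q)$ such that $$\Pr\bigl(u^{(0)}\to v^{(0)}\bigr)<\Pr\bigl(u^{(0)}\to v^{(1)}\bigr),$$ where $x\to y$ denotes the event that the retained edges contain a path from $x$ to $y$ (a directed path in the digraph cases), and the random set of retained edges is chosen uniformly from $\mathcal{E}(\tilde Q)$: (1) model $E_1$ on some finite simple graph $G$; (2) model $E_2^T$ on some finite simple graph $G$ and some $T\subseteq V(G)$; (3) model $E_4^T$ on some finite hypergraph $\mathcal{H}$ and some $T\subseteq V(\mathcal{H})$; (4) model $E_5$ on some finite hypergraph $\mathcal{H}$; (5) model $E_6^{T,F}$ on some finite digraph $D$, some $T\subseteq V(D)$ and some $F\subseteq E(D)$; (6) model $E_7$ on some finite directed multigraph $D$.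
   Context: Bunkbed structure: for $Q$ a graph, hypergraph, or (multi)digraph, $\tilde Q$ is formed by taking two copies $Q_0$ (lower bunk) and $Q_1$ (upper bunk) of $Q$, writing $v^{(i)}$ and $e^{(i)}$ for the copies of vertex $v$ and edge $e$ in $Q_i$ (the edges $e^{(i)}$ are called horizontal), and adding for each $v\in V(Q)$ a vertical edge $v^{(0)}v^{(1)}$ (an ordinary 2-element edge; in the directed cases it is bidirectional, i.e. can be traversed in both directions). A percolation model $\mathcal{E}(\tilde Q)$ is a family of subsets of $E(\tilde Q)$; one picks $X\in\mathcal{E}(\tilde Q)$ uniformly at random and retains exactly the edges in $X$. In a hypergraph, a path is a sequence of vertices in which consecutive vertices lie together in some retained hyperedge. The models: $E_1$ (graph $G$): a set $U\subseteq V(\tilde G)$ of open vertices is chosen uniformly among all subsets of $V(\tilde G)$, and exactly the edges of $\tilde G$ with both endpoints in $U$ are retained. $E_2^T$ (graph $G$, $T\subseteq V(G)$): the open set $U\subseteq V(\tilde G)$ is chosen uniformly among all sets such that for $v\in T$ both $v^{(0)},v^{(1)}\in U$, and for $v\notin T$ exactly one of $v^{(0)},v^{(1)}$ is in $U$; exactly the edges with both endpoints in $U$ are retained. $E_4^T$ (hypergraph $\mathcal{H}$, $T\subseteq V(\mathcal{H})$): the family of all $X\subseteq E(\tilde{\mathcal{H}})$ containing exactly one of $e^{(0)},e^{(1)}$ for each $e\in E(\mathcal{H})$, and containing exactly those vertical edges $v^{(0)}v^{(1)}$ with $v\in T$. $E_5$ (hypergraph $\mathcal{H}$): all subsets of $E(\tilde{\mathcal{H}})$.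 $E_6^{T,F}$ (digraph $D$, $T\subseteq V(D)$, $F\subseteq E(D)$): the family of all $X\subseteq E(\tilde D)$ containing both $e^{(0)}$ and $e^{(1)}$ for every $e\in F$, exactly one of $e^{(0)},e^{(1)}$ for every $e\in E(D)\setminus F$, and exactly those vertical edges $v^{(0)}v^{(1)}$ with $v\in T$. $E_7$ (directed multigraph $D$): all subsets of $E(\tilde D)$. -}

module Defs where

open import Data.Nat using (ℕ; zero; suc; _<_)
open import Data.Bool using (Bool; true; false; not)
open import Data.Fin using (Fin)
open import Data.Vec using (Vec; []; _∷_; lookup)
open import Data.List using (List; []; _∷_; [_]; concatMap; cartesianProduct)
open import Data.Product using (_×_; _,_; proj₁; proj₂; Σ; ∃)
open import Data.Unit using (⊤)
open import Relation.Nullary using (¬_)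
open import Relation.Binary.PropositionalEquality using (_≡_; _≢_)
open import Relation.Binary.Construct.Closure.ReflexiveTransitive using (Star)

-- All subsets of a k-element set, as characteristic vectors (no duplicates).
allVec : (k : ℕ) → List (Vec Bool k)
allVec zero    = [ [] ]
allVec (suc k) = concatMap (λ v → (false ∷ v) ∷ (true ∷ v) ∷ []) (allVec k)

data CountIn {A : Set} (P : A → Set) : List A → ℕ → Set where
  cnil : CountIn P [] 0
  cyes : ∀ {x xs k} → P x → CountIn P xs k → CountIn P (x ∷ xs) (suc k)
  cno  : ∀ {x xs k} → ¬ P x → CountIn P xs k → CountIn P (x ∷ xs) k

_∩_ : {A : Set} → (A → Set) → (A → Set) → A → Set
(P ∩ Q) x = P x × Q x

-- Pr(A) < Pr(B) where the sample is chosen uniformly from the (duplicate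
-- free) enumeration S restricted to the admissible samples Valid.  Since
-- both probabilities have the same denominator #{s ∈ S | Valid s}, this is
-- #{s | Valid s ∧ A s} < #{s | Valid s ∧ B s}.
PrLess : {Ω : Set} → List Ω → (Valid A B : Ω → Set) → Set
PrLess S Valid A B =
  Σ ℕ λ a → Σ ℕ λ b → CountIn (Valid ∩ A) S a × CountIn (Valid ∩ B) S b × a < b

-- Bunkbed vertices: (v , false) = v^(0) (lower), (v , true) = v^(1) (upper)

TV : ℕ → Set
TV n = Fin n × Bool

layer : {A : Set} → Bool → A × A → A
layer false p = proj₁ p
layer true  p = proj₂ p

record SimpleGraph (n : ℕ) : Set where
  field
    adj    : Fin n → Fin n → Bool
    sym    : ∀ a b → adj a b ≡ adj b a
    irrefl : ∀ a → adj a a ≡ false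

-- Open vertex set U ⊆ V(G̃): (lower-bunk indicator , upper-bunk indicator)
OpenSet : ℕ → Set
OpenSet n = Vec Bool n × Vec Bool n

isOpen : ∀ {n} → OpenSet n → TV n → Bool
isOpen U (a , i) = lookup (layer i U) a

data SiteStep {n : ℕ} (G : SimpleGraph n) (U : OpenSet n) : TV n → TV n → Set where
  horiz : ∀ {a b i} → SimpleGraph.adj G a b ≡ true →
          isOpen U (a , i) ≡ true → isOpen U (b , i) ≡ true →
          SiteStep G U (a , i) (b , i)
  vert  : ∀ {a i} → isOpen U (a , i) ≡ true → isOpen U (a , not i) ≡ true →
          SiteStep G U (a , i) (a , not i)

allOpenSets : (n : ℕ) → List (OpenSet n)
allOpenSets n = cartesianProduct (allVec n) (allVec n)

E1-PrLess : ∀ {n} → SimpleGraph n → Fin n → Fin n → Set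
E1-PrLess {n} G u v =
  PrLess (allOpenSets n) (λ _ → ⊤)
    (λ U → Star (SiteStep G U) (u , false) (v , false))
    (λ U → Star (SiteStep G U) (u , false) (v , true))

E2-Valid : ∀ {n} → Vec Bool n → OpenSet n → Set
E2-Valid {n} T (lo , up) =
  (a : Fin n) →
    (lookup T a ≡ true  → lookup lo a ≡ true × lookup up a ≡ true) ×
    (lookup T a ≡ false → lookup lo a ≡ not (lookup up a))

E2-PrLess : ∀ {n} → SimpleGraph n → Vec Bool n → Fin n → Fin n → Set
E2-PrLess {n} G T u v =
  PrLess (allOpenSets n) (E2-Valid T)
    (λ U → Star (SiteStep G U) (u , false) (v , false))
    (λ U → Star (SiteStep G U) (u , false) (v , true))

-- Retained-edge sets X ⊆ E(Q̃) for Q with m edges and n vertices: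
-- ((lower copies e^(0) , upper copies e^(1)) , vertical edges v^(0)v^(1))

EdgeSel : ℕ → ℕ → Set
EdgeSel m n = (Vec Bool m × Vec Bool m) × Vec Bool n

hor : ∀ {m n} → EdgeSel m n → Bool → Vec Bool m
hor X i = layer i (proj₁ X)

verts : ∀ {m n} → EdgeSel m n → Vec Bool n
verts X = proj₂ X

allEdgeSels : (m n : ℕ) → List (EdgeSel m n)
allEdgeSels m n = cartesianProduct (cartesianProduct (allVec m) (allVec m)) (allVec n)

record Hypergraph (n m : ℕ) : Set where
  field
    edge     : Fin m → Vec Bool n
    nonempty : ∀ e → ∃ λ a → lookup (edge e) a ≡ true
    distinct : ∀ e f → edge e ≡ edge f → e ≡ f

data HStep {n m : ℕ} (H : Hypergraph n m) (X : EdgeSel m n) : TV n → TV n → Set where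
  horiz : ∀ {a b i} (e : Fin m) → lookup (hor X i) e ≡ true →
          lookup (Hypergraph.edge H e) a ≡ true → lookup (Hypergraph.edge H e) b ≡ true →
          HStep H X (a , i) (b , i)
  vert  : ∀ {a i} → lookup (verts X) a ≡ true → HStep H X (a , i) (a , not i)

E4-Valid : ∀ {m n} → Vec Bool n → EdgeSel m n → Set
E4-Valid {m} T X =
  ((e : Fin m) → lookup (hor X false) e ≡ not (lookup (hor X true) e)) × verts X ≡ T

E4-PrLess : ∀ {n m} → Hypergraph n m → Vec Bool n → Fin n → Fin n → Set
E4-PrLess {n} {m} H T u v =
  PrLess (allEdgeSels m n) (E4-Valid T)
    (λ X → Star (HStep H X) (u , false) (v , false))
    (λ X → Star (HStep H X) (u , false) (v , true))

E5-PrLess : ∀ {n m} → Hypergraph n m → Fin n → Fin n → Set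
E5-PrLess {n} {m} H u v =
  PrLess (allEdgeSels m n) (λ _ → ⊤)
    (λ X → Star (HStep H X) (u , false) (v , false))
    (λ X → Star (HStep H X) (u , false) (v , true))

record Digraph (n m : ℕ) : Set where
  field
    arc      : Fin m → Fin n × Fin n          -- arc e = (tail , head)
    loopless : ∀ e → proj₁ (arc e) ≢ proj₂ (arc e)
    distinct : ∀ e f → arc e ≡ arc f → e ≡ f

record MultiDigraph (n m : ℕ) : Set where
  field
    arc : Fin m → Fin n × Fin n

data DStep {n m : ℕ} (arc : Fin m → Fin n × Fin n) (X : EdgeSel m n) : TV n → TV n → Set where
  horiz : ∀ {a b i} (e : Fin m) → lookup (hor X i) e ≡ true → arc e ≡ (a , b) →
          DStep arc X (a , i) (b , i)
  vert  : ∀ {a i} → lookup (verts X) a ≡ true → DStep arc X (a , i) (a , not i)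

E6-Valid : ∀ {m n} → Vec Bool n → Vec Bool m → EdgeSel m n → Set
E6-Valid {m} T F X =
  ((e : Fin m) →
    (lookup F e ≡ true  → lookup (hor X false) e ≡ true × lookup (hor X true) e ≡ true) ×
    (lookup F e ≡ false → lookup (hor X false) e ≡ not (lookup (hor X true) e))) ×
  verts X ≡ T

E6-PrLess : ∀ {n m} → Digraph n m → Vec Bool n → Vec Bool m → Fin n → Fin n → Set
E6-PrLess {n} {m} D T F u v =
  PrLess (allEdgeSels m n) (E6-Valid T F)
    (λ X → Star (DStep (Digraph.arc D) X) (u , false) (v , false))
    (λ X → Star (DStep (Digraph.arc D) X) (u , false) (v , true))

E7-PrLess : ∀ {n m} → MultiDigraph n m → Fin n → Fin n → Set
E7-PrLess {n} {m} D u v =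
  PrLess (allEdgeSels m n) (λ _ → ⊤)
    (λ X → Star (DStep (MultiDigraph.arc D) X) (u , false) (v , false))
    (λ X → Star (DStep (MultiDigraph.arc D) X) (u , false) (v , true))

{-# OPTIONS --safe #-}

-- Let a₁ … a₆ be a path and let three hubs be adjacent to {a₁,a₃}, {a₂,a₅} and {a₄,a₆}.  Suppose
-- that both copies of every hub are always open, hence connected.  Among the 4⁶ choices of open
-- copies of the aᵢ, 703 connect the lower copies of a₁ and a₆ and 704 connect the lower copy of a₁
-- with the upper copy of a₆; among the 2⁶ choices of exactly one copy of each aᵢ it is 12 and 13.
-- The same numbers occur for the hypergraph with edges eᵢ = {xᵢ₋₁, xᵢ, hub of aᵢ}, and an
-- orientated variant with four random arcs and seven arcs that are always present gives 160 against
-- 161 out of 4⁴, and 12 against 13 out of 2⁴.  This settles E₂, E₄ and E₆.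
--
-- In E₁, E₅ and E₇ nothing is always present.  Each hub is replaced by many copies (in E₇ it gets
-- many satellites, and the arcs that should be present are multiplied), so that it connects the two
-- bunks with probability so close to 1 that an advantage of one configuration survives.  The random
-- vertical edges at the xᵢ do no harm: if there is one at xₖ, then reflecting the part of the path
-- above xₖ, which interacts with the rest only through xₖ and the hubs, shows that both
-- events are equally likely.

module Submission where

open import Defs
open import Data.Bool using (Bool; _xor_; _∧_; _∨_; false; if_then_else_; not; true)
open import Data.Bool.ListAction using (all; any)
import Data.Bool.Properties as Boolₚ
open import Data.Fin as Fin using (Fin; _↑ʳ_; _↑ˡ_; combine; inject₁; quotient; remQuot; splitAt; suc; zero)
open import Data.Fin.Patterns
import Data.Fin.Properties as Finₚ
open import Data.List using (List; []; [_]; _++_; _∷_; allFin; cartesianProduct; concatMap; filterᵇ; foldl; map)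
open import Data.List.Membership.Propositional using (_∈_; find; lose)
open import Data.List.Membership.Propositional.Properties using (∈-++⁺ʳ; ∈-++⁺ˡ; ∈-allFin; ∈-cartesianProduct⁺; ∈-map⁺; ∈-map⁻)
open import Data.List.Relation.Unary.All as All using (All)
open import Data.List.Relation.Unary.Any as Any using (Any; any?; here; there)
open import Data.List.Relation.Unary.Any.Properties using (++⁺ʳ; ++⁺ˡ; ++⁻; concatMap⁺; concatMap⁻)
open import Data.Maybe using (Maybe; just; nothing)
open import Data.Nat using (_*_; _+_; _<_; _^_; _∸_; _≤_; suc; zero; z≤n; ℕ)
open import Data.Nat.Properties
open import Algebra.Properties.CommutativeSemigroup +-commutativeSemigroup using (interchange)
open import Data.Product as Product using (_,_; _×_; proj₁; proj₂; Σ; ∃)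
open import Data.Product.Properties using () renaming (≡-dec to ×-≡-dec)
open import Data.Sum as Sum using ([_,_]′; _⊎_; inj₁; inj₂)
open import Data.Sum.Properties using () renaming (≡-dec to ⊎-≡-dec)
open import Data.Unit using (tt; ⊤)
open import Data.Vec as Vec using (Vec; []; _[_]%=_; _[_]≔_; _∷_; lookup; replicate; tabulate; zipWith)
import Data.Vec.Properties as Vecₚ
open import Function using (Equivalence; _⇔_; _∘_; id; mk⇔)
open import Relation.Binary.Construct.Closure.ReflexiveTransitive using (Star; _◅_; _◅◅_; kleisliStar; ε)
open import Relation.Binary.Definitions using (Decidable; DecidableEquality; tri<; tri>; tri≈)
open import Relation.Binary.PropositionalEquality hiding ([_])
open import Relation.Nullary using (Dec; contradiction; does; no; yes; ¬_)
open import Relation.Nullary.Decidable using (_×-dec_; _→-dec_; _⊎-dec_; dec-false; dec-true; does-⇔; from-yes; map′; ¬?)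

-- The surplus of 1 can be seen by hand. With exactly one copy of each aᵢ open, the hubs glue the
-- path into the classes {a₁,a₃}, {a₂,a₅}, {a₄,a₆}, and aᵢ, aᵢ₊₁ are directly joined exactly if
-- their open copies are on the same level. The first and last class are separated iff the level
-- changes between a₃ and a₄ and, in addition, at both steps of a₁a₂a₃ or at both steps of a₄a₅a₆.
-- Of the seven patterns of changes that do this, four have an even and three an odd number of
-- changes. So, with a₁ open on the lower level, 16 - 4 choices reach a₆ below and 16 - 3 reach it
-- above. Among all 4⁶ choices the surplus is again 1, because those in which some aₖ has both or
-- neither copy open cancel: reflect beyond the first such k. The structures without forced edges
-- have far too many samples to enumerate. Sums over them are split into a small core and the
-- choices at hubs and multiplied arcs; where the latter are good, both copies of a hub collapse to
-- one point, and only the core is computed.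

variable
  A B : Set
  m n p q r : ℕ

-- Finite sums and counting

opaque
  -- Opaque, so that conversion checking never expands a sum over an astronomically long list; only
  -- the blocks that unfold it compute with it.
  ∑ : List A → (A → ℕ) → ℕ
  ∑ []       f = 0
  ∑ (x ∷ xs) f = f x + ∑ xs f

opaque
  unfolding ∑

  ∑-cong : {f g : A → ℕ} (xs : List A) → (∀ x → f x ≡ g x) → ∑ xs f ≡ ∑ xs g
  ∑-cong []       e = refl
  ∑-cong (x ∷ xs) e = cong₂ _+_ (e x) (∑-cong xs e)

  ∑-mono : {f g : A → ℕ} (xs : List A) → (∀ x → f x ≤ g x) → ∑ xs f ≤ ∑ xs g
  ∑-mono []       e = z≤n
  ∑-mono (x ∷ xs) e = +-mono-≤ (e x) (∑-mono xs e)

  ∑-mono-< : {f g : A → ℕ} {xs : List A} {y : A} → (∀ x → f x ≤ g x) → y ∈ xs → f y < g y →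
             ∑ xs f < ∑ xs g
  ∑-mono-< {xs = x ∷ xs} e (here refl) lt = +-mono-<-≤ lt (∑-mono xs e)
  ∑-mono-< {xs = x ∷ xs} e (there y∈) lt = +-mono-≤-< (e x) (∑-mono-< e y∈ lt)

  ∑-+ : {f g : A → ℕ} (xs : List A) → ∑ xs (λ x → f x + g x) ≡ ∑ xs f + ∑ xs g
  ∑-+ []       = refl
  ∑-+ {f = f} {g} (x ∷ xs) =
    trans (cong (f x + g x +_) (∑-+ xs)) (interchange (f x) (g x) (∑ xs f) (∑ xs g))

  ∑-* : (c : ℕ) {f : A → ℕ} (xs : List A) → ∑ xs (λ x → c * f x) ≡ c * ∑ xs f
  ∑-* c []       = sym (*-zeroʳ c)
  ∑-* c {f} (x ∷ xs) = trans (cong (c * f x +_) (∑-* c xs)) (sym (*-distribˡ-+ c (f x) (∑ xs f)))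

  ∑-zero : (xs : List A) → ∑ xs (λ _ → 0) ≡ 0
  ∑-zero []       = refl
  ∑-zero (x ∷ xs) = ∑-zero xs

  ∑-++ : {f : A → ℕ} (xs ys : List A) → ∑ (xs ++ ys) f ≡ ∑ xs f + ∑ ys f
  ∑-++ []       ys = refl
  ∑-++ {f = f} (x ∷ xs) ys = trans (cong (f x +_) (∑-++ xs ys)) (sym (+-assoc (f x) _ _))

  ∑-map : {f : B → ℕ} (g : A → B) (xs : List A) → ∑ (map g xs) f ≡ ∑ xs (f ∘ g)
  ∑-map g []       = refl
  ∑-map {f = f} g (x ∷ xs) = cong (f (g x) +_) (∑-map g xs)

  ∑-concatMap : {f : B → ℕ} (g : A → List B) (xs : List A) →
                ∑ (concatMap g xs) f ≡ ∑ xs (λ x → ∑ (g x) f)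
  ∑-concatMap g []       = refl
  ∑-concatMap {f = f} g (x ∷ xs) =
    trans (∑-++ (g x) (concatMap g xs)) (cong (∑ (g x) f +_) (∑-concatMap g xs))

  ∑-× : {f : A × B → ℕ} (xs : List A) (ys : List B) →
        ∑ (cartesianProduct xs ys) f ≡ ∑ xs (λ x → ∑ ys (λ y → f (x , y)))
  ∑-× []       ys = refl
  ∑-× {f = f} (x ∷ xs) ys =
    trans (∑-++ (map (x ,_) ys) _) (cong₂ _+_ (∑-map (x ,_) ys) (∑-× xs ys))

  ∑-comm : {f : A → B → ℕ} (xs : List A) (ys : List B) →
           ∑ xs (λ x → ∑ ys (f x)) ≡ ∑ ys (λ y → ∑ xs (λ x → f x y))
  ∑-comm []       ys = sym (∑-zero ys)
  ∑-comm {f = f} (x ∷ xs) ys = trans (cong (∑ ys (f x) +_) (∑-comm xs ys)) (sym (∑-+ ys))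

opaque
  unfolding ∑

  ∑-singleton : (x : A) {f : A → ℕ} → ∑ [ x ] f ≡ f x
  ∑-singleton x = +-identityʳ _

size : List A → ℕ
size xs = ∑ xs (λ _ → 1)

bit : Bool → ℕ
bit true  = 1
bit false = 0

bit-∧ : ∀ x y → bit (x ∧ y) ≡ bit x * bit y
bit-∧ true  y = sym (*-identityˡ (bit y))
bit-∧ false y = refl

ind : {P : Set} → Dec P → ℕ
ind p = bit (does p)

ind≤1 : {P : Set} (p : Dec P) → ind p ≤ 1
ind≤1 (yes _) = ≤-refl
ind≤1 (no _)  = z≤n

ind-⇔ : {P Q : Set} → P ⇔ Q → (p : Dec P) (q : Dec Q) → ind p ≡ ind q
ind-⇔ e p q = cong bit (does-⇔ e p q)

ind-× : {P Q : Set} (p : Dec P) (q : Dec Q) → ind (p ×-dec q) ≡ ind p * ind q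
ind-× p q = bit-∧ (does p) (does q)

opaque
  unfolding ∑

  countIn : {P : A → Set} (P? : ∀ x → Dec (P x)) (xs : List A) → CountIn P xs (∑ xs (ind ∘ P?))
  countIn P? []       = cnil
  countIn P? (x ∷ xs) with P? x
  ... | yes p = cyes p (countIn P? xs)
  ... | no ¬p = cno ¬p (countIn P? xs)

-- Validity stays a separate factor, so that `∑-restrict` can later absorb it into the list summed
-- over.
prLess : {S : List A} {V P Q : A → Set}
         (V? : ∀ x → Dec (V x)) (P? : ∀ x → Dec (P x)) (Q? : ∀ x → Dec (Q x)) →
         ∑ S (λ x → ind (V? x) * ind (P? x)) < ∑ S (λ x → ind (V? x) * ind (Q? x)) →
         PrLess S V P Q
prLess {S = S} V? P? Q? lt =
  _ , _ , countIn (λ x → V? x ×-dec P? x) S , countIn (λ x → V? x ×-dec Q? x) S ,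
  subst₂ _<_ (∑-cong S (λ x → sym (ind-× (V? x) (P? x)))) (∑-cong S (λ x → sym (ind-× (V? x) (Q? x)))) lt

-- An advantage of at least 1 for each good w outweighs a loss of at most size Cs for each bad w.
thicken : {Cs : List A} {Ws : List B} {P Q : A → B → ℕ} {P₀ Q₀ : A → ℕ} (good : B → Bool) →
          (∀ c w → P c w ≤ 1) →
          (∀ c w → good w ≡ true → P c w ≡ P₀ c × Q c w ≡ Q₀ c) →
          ∑ Cs P₀ < ∑ Cs Q₀ →
          size Cs * size Ws < suc (size Cs) * ∑ Ws (bit ∘ good) →
          ∑ Cs (λ c → ∑ Ws (P c)) < ∑ Cs (λ c → ∑ Ws (Q c))
thicken {A = A} {B} {Cs} {Ws} {P} {Q} {P₀} {Q₀} good P≤1 same lt few =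
  subst₂ _<_ (∑-comm Ws Cs) (∑-comm Ws Cs) (+-cancelʳ-< (suc c * g) _ _ total)
  where
  c = size Cs
  g = ∑ Ws (bit ∘ good)
  ΣP ΣQ : B → ℕ
  ΣP w = ∑ Cs (λ x → P x w)
  ΣQ w = ∑ Cs (λ x → Q x w)
  -- Adding `c` on the right puts both cases into one inequality: a good `w` gains at least 1, a bad
  -- `w` loses at most `c`. After summation, `few` says that the gains win.
  pointwise : ∀ w → ΣP w + suc c * bit (good w) ≤ ΣQ w + c * 1
  pointwise w with good w in eq
  ... | false = begin
    ΣP w + c * 0   ≡⟨ cong (ΣP w +_) (*-zeroʳ c) ⟩
    ΣP w + 0       ≡⟨ +-identityʳ (ΣP w) ⟩
    ΣP w           ≤⟨ ∑-mono Cs (λ x → P≤1 x w) ⟩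
    c             ≤⟨ m≤n+m c (ΣQ w) ⟩
    ΣQ w + c       ≡⟨ cong (ΣQ w +_) (sym (*-identityʳ c)) ⟩
    ΣQ w + c * 1   ∎
    where open ≤-Reasoning
  ... | true = begin
    ΣP w + suc (c * 1)   ≡⟨ +-suc (ΣP w) (c * 1) ⟩
    suc (ΣP w) + c * 1   ≡⟨ cong (λ z → suc z + c * 1) (∑-cong Cs (λ x → proj₁ (same x w eq))) ⟩
    suc (∑ Cs P₀) + c * 1 ≤⟨ +-monoˡ-≤ (c * 1) lt ⟩
    ∑ Cs Q₀ + c * 1     ≡⟨ cong (_+ c * 1) (∑-cong Cs (λ x → sym (proj₂ (same x w eq)))) ⟩
    ΣQ w + c * 1         ∎
    where open ≤-Reasoning
  total : ∑ Ws ΣP + suc c * g < ∑ Ws ΣQ + suc c * g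
  total = begin-strict
    ∑ Ws ΣP + suc c * g                               ≡⟨ cong (∑ Ws ΣP +_) (sym (∑-* (suc c) Ws)) ⟩
    ∑ Ws ΣP + ∑ Ws (λ w → suc c * bit (good w))       ≡⟨ sym (∑-+ Ws) ⟩
    ∑ Ws (λ w → ΣP w + suc c * bit (good w))          ≤⟨ ∑-mono Ws pointwise ⟩
    ∑ Ws (λ w → ΣQ w + c * 1)                         ≡⟨ ∑-+ Ws ⟩
    ∑ Ws ΣQ + ∑ Ws (λ _ → c * 1)                      ≡⟨ cong (∑ Ws ΣQ +_) (∑-* c Ws) ⟩
    ∑ Ws ΣQ + c * size Ws                             <⟨ +-monoʳ-< (∑ Ws ΣQ) few ⟩
    ∑ Ws ΣQ + suc c * g                               ∎
    where open ≤-Reasoning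

-- Sums over product spaces.

words : Vec (List A) n → List (Vec A n)
words []       = [ [] ]
words (l ∷ ls) = concatMap (λ a → map (a ∷_) (words ls)) l

tuples : (n : ℕ) → List A → List (Vec A n)
tuples n l = words (replicate n l)

opaque
  unfolding ∑

  ∑-words : (l : List A) (ls : Vec (List A) n) {f : Vec A (suc n) → ℕ} →
            ∑ (words (l ∷ ls)) f ≡ ∑ l (λ a → ∑ (words ls) (λ w → f (a ∷ w)))
  ∑-words l ls = trans (∑-concatMap _ l) (∑-cong l (λ a → ∑-map (a ∷_) (words ls)))

  ∑-words-++ : (ls : Vec (List A) m) (ls′ : Vec (List A) n) {f : Vec A (m + n) → ℕ} →
               ∑ (words (ls Vec.++ ls′)) f ≡ ∑ (words ls) (λ w → ∑ (words ls′) (λ w′ → f (w Vec.++ w′)))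
  ∑-words-++ []       ls′ = sym (+-identityʳ _)
  ∑-words-++ (l ∷ ls) ls′ =
    trans (∑-words l (ls Vec.++ ls′))
          (trans (∑-cong l (λ a → ∑-words-++ ls ls′)) (sym (∑-words l ls)))

  ∑-tuples-+ : (m : ℕ) {l : List A} {f : Vec A (m + n) → ℕ} →
               ∑ (tuples (m + n) l) f ≡ ∑ (tuples m l) (λ w → ∑ (tuples n l) (λ w′ → f (w Vec.++ w′)))
  ∑-tuples-+ {n = n} m {l} {f} =
    trans (cong (λ ls → ∑ (words ls) f) (replicate-++ m)) (∑-words-++ (replicate m l) (replicate n l))
    where
    replicate-++ : ∀ m → replicate (m + n) l ≡ replicate m l Vec.++ replicate n l
    replicate-++ zero    = refl
    replicate-++ (suc m) = cong (l ∷_) (replicate-++ m)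

  ∑-tuples-* : (m : ℕ) {l : List A} {f : Vec A (m * n) → ℕ} →
               ∑ (tuples (m * n) l) f ≡ ∑ (tuples m (tuples n l)) (λ ws → f (Vec.concat ws))
  ∑-tuples-* zero = refl
  ∑-tuples-* {n = n} (suc m) {l} =
    trans (∑-tuples-+ n)
          (trans (∑-cong (tuples n l) (λ w → ∑-tuples-* m)) (sym (∑-words (tuples n l) (replicate m (tuples n l)))))

  size-× : (xs : List A) (ys : List B) → size (cartesianProduct xs ys) ≡ size xs * size ys
  size-× xs ys = begin
    size (cartesianProduct xs ys)    ≡⟨ ∑-× xs ys ⟩
    ∑ xs (λ _ → size ys)             ≡⟨ ∑-cong xs (λ _ → sym (*-identityʳ (size ys))) ⟩
    ∑ xs (λ _ → size ys * 1)         ≡⟨ ∑-* (size ys) xs ⟩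
    size ys * size xs                ≡⟨ *-comm (size ys) (size xs) ⟩
    size xs * size ys                ∎
    where open ≡-Reasoning

  ∑-∧ : (P : A → Bool) (Q : B → Bool) (xs : List A) (ys : List B) →
        ∑ (cartesianProduct xs ys) (λ (x , y) → bit (P x ∧ Q y)) ≡ ∑ xs (bit ∘ P) * ∑ ys (bit ∘ Q)
  ∑-∧ P Q xs ys = begin
    ∑ (cartesianProduct xs ys) (λ (x , y) → bit (P x ∧ Q y))
      ≡⟨ ∑-× xs ys ⟩
    ∑ xs (λ x → ∑ ys (λ y → bit (P x ∧ Q y)))
      ≡⟨ ∑-cong xs (λ x → trans (∑-cong ys (λ y → bit-∧ (P x) (Q y)))
                                (trans (∑-* (bit (P x)) ys) (*-comm (bit (P x)) _))) ⟩
    ∑ xs (λ x → ∑ ys (bit ∘ Q) * bit (P x))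
      ≡⟨ ∑-* (∑ ys (bit ∘ Q)) xs ⟩
    ∑ ys (bit ∘ Q) * ∑ xs (bit ∘ P)
      ≡⟨ *-comm (∑ ys (bit ∘ Q)) (∑ xs (bit ∘ P)) ⟩
    ∑ xs (bit ∘ P) * ∑ ys (bit ∘ Q)
      ∎
    where open ≡-Reasoning

  size-tuples : (n : ℕ) (l : List A) → size (tuples n l) ≡ size l ^ n
  size-tuples zero    l = refl
  size-tuples (suc n) l = begin
    size (tuples (suc n) l)                    ≡⟨ ∑-words l (replicate n l) ⟩
    ∑ l (λ _ → size (tuples n l))              ≡⟨ ∑-cong l (λ _ → trans (size-tuples n l) (sym (*-identityʳ _))) ⟩
    ∑ l (λ _ → size l ^ n * 1)                 ≡⟨ ∑-* (size l ^ n) l ⟩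
    size l ^ n * size l                        ≡⟨ *-comm (size l ^ n) (size l) ⟩
    size l * size l ^ n                        ∎
    where open ≡-Reasoning

every : (A → Bool) → Vec A n → Bool
every P []      = true
every P (x ∷ w) = P x ∧ every P w

opaque
  unfolding ∑

  ∑-every : (P : A → Bool) (n : ℕ) (l : List A) →
            ∑ (tuples n l) (bit ∘ every P) ≡ ∑ l (bit ∘ P) ^ n
  ∑-every P zero    l = refl
  ∑-every P (suc n) l = begin
    ∑ (tuples (suc n) l) (bit ∘ every P)
      ≡⟨ ∑-words l (replicate n l) ⟩
    ∑ l (λ a → ∑ (tuples n l) (λ w → bit (P a ∧ every P w)))
      ≡⟨ ∑-cong l (λ a → trans (∑-cong (tuples n l) (λ w → bit-∧ (P a) (every P w)))
                                (trans (∑-* (bit (P a)) (tuples n l)) (*-comm (bit (P a)) _))) ⟩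
    ∑ l (λ a → ∑ (tuples n l) (bit ∘ every P) * bit (P a))
      ≡⟨ ∑-* (∑ (tuples n l) (bit ∘ every P)) l ⟩
    ∑ (tuples n l) (bit ∘ every P) * ∑ l (bit ∘ P)
      ≡⟨ cong (_* ∑ l (bit ∘ P)) (∑-every P n l) ⟩
    ∑ l (bit ∘ P) ^ n * ∑ l (bit ∘ P)
      ≡⟨ *-comm (∑ l (bit ∘ P) ^ n) (∑ l (bit ∘ P)) ⟩
    ∑ l (bit ∘ P) ^ suc n
      ∎
    where open ≡-Reasoning

every-lookup : (P : A → Bool) (w : Vec A n) → every P w ≡ true → ∀ i → P (lookup w i) ≡ true
every-lookup P (x ∷ w) e i       with P x in eq | e
every-lookup P (x ∷ w) e zero    | true | _ = eq
every-lookup P (x ∷ w) e (suc i) | true | e′ = every-lookup P w e′ i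

some : (A → Bool) → Vec A n → Bool
some P w = not (every (not ∘ P) w)

some-lookup : (P : A → Bool) (w : Vec A n) → some P w ≡ true → ∃ λ i → P (lookup w i) ≡ true
some-lookup P (x ∷ w) e with P x in eq
... | true  = zero , eq
... | false with some-lookup P w e
...   | i , e′ = suc i , e′

opaque
  unfolding ∑

  -- A word fails exactly if all its letters miss `P`, which `∑-every` counts. The additive form
  -- postpones truncated subtraction to `∑-groups`.
  ∑-some : (P : A → Bool) (n : ℕ) (l : List A) →
           ∑ (tuples n l) (bit ∘ some P) + ∑ l (bit ∘ not ∘ P) ^ n ≡ size l ^ n
  ∑-some P n l = begin
    ∑ (tuples n l) (bit ∘ some P) + ∑ l (bit ∘ not ∘ P) ^ n
      ≡⟨ cong (∑ (tuples n l) (bit ∘ some P) +_) (sym (∑-every (not ∘ P) n l)) ⟩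
    ∑ (tuples n l) (bit ∘ some P) + ∑ (tuples n l) (bit ∘ every (not ∘ P))
      ≡⟨ sym (∑-+ (tuples n l)) ⟩
    ∑ (tuples n l) (λ w → bit (some P w) + bit (every (not ∘ P) w))
      ≡⟨ ∑-cong (tuples n l) (λ w → complement (every (not ∘ P) w)) ⟩
    size (tuples n l)
      ≡⟨ size-tuples n l ⟩
    size l ^ n
      ∎
    where
    open ≡-Reasoning
    complement : ∀ b → bit (not b) + bit b ≡ 1
    complement true  = refl
    complement false = refl

-- (lower copy , upper copy)
Letter : Set
Letter = Bool × Bool

two : List Bool
two = false ∷ true ∷ []

-- The order of the letters matters: filtering `four` by a condition on the letter must give `oneOf`
-- or `both` by computation.
four oneOf both : List Letter
four  = cartesianProduct two two
oneOf = (false , true) ∷ (true , false) ∷ []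
both  = [ (true , true) ]

unzip : Vec Letter n → Vec Bool n × Vec Bool n
unzip w = Vec.map proj₁ w , Vec.map proj₂ w

lookup-unzip : (w : Vec Letter n) (i : Bool) (a : Fin n) → lookup (layer i (unzip w)) a ≡ layer i (lookup w a)
lookup-unzip (x ∷ w) false zero    = refl
lookup-unzip (x ∷ w) true  zero    = refl
lookup-unzip (x ∷ w) false (suc a) = lookup-unzip w false a
lookup-unzip (x ∷ w) true  (suc a) = lookup-unzip w true a

opaque
  unfolding ∑

  -- In `allVec` the first bit varies fastest, in `words` slowest; hence the exchange of sums.
  ∑-allVec : (n : ℕ) {f : Vec Bool n → ℕ} → ∑ (allVec n) f ≡ ∑ (tuples n two) f
  ∑-allVec zero    = refl
  ∑-allVec (suc n) {f} = begin
    ∑ (allVec (suc n)) f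
      ≡⟨ ∑-concatMap _ (allVec n) ⟩
    ∑ (allVec n) (λ v → ∑ two (λ b → f (b ∷ v)))
      ≡⟨ ∑-comm {f = λ v b → f (b ∷ v)} (allVec n) two ⟩
    ∑ two (λ b → ∑ (allVec n) (λ v → f (b ∷ v)))
      ≡⟨ ∑-cong two (λ b → ∑-allVec n {λ v → f (b ∷ v)}) ⟩
    ∑ two (λ b → ∑ (tuples n two) (λ v → f (b ∷ v)))
      ≡⟨ sym (∑-words two (replicate n two)) ⟩
    ∑ (tuples (suc n) two) f
      ∎
    where open ≡-Reasoning

  -- The samples list all lower indicators and then all upper ones. Regrouped into one letter per
  -- vertex or edge, they form a product of independent coordinates, on which restrictions and
  -- reflections act letter by letter.
  ∑-unzip : (n : ℕ) {f : Vec Bool n × Vec Bool n → ℕ} →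
            ∑ (cartesianProduct (allVec n) (allVec n)) f ≡ ∑ (tuples n four) (f ∘ unzip)
  ∑-unzip n {f} = begin
    ∑ (cartesianProduct (allVec n) (allVec n)) f
      ≡⟨ ∑-× (allVec n) (allVec n) ⟩
    ∑ (allVec n) (λ v → ∑ (allVec n) (λ v′ → f (v , v′)))
      ≡⟨ trans (∑-cong (allVec n) (λ v → ∑-allVec n)) (∑-allVec n) ⟩
    ∑ (tuples n two) (λ v → ∑ (tuples n two) (λ v′ → f (v , v′)))
      ≡⟨ go n ⟩
    ∑ (tuples n four) (f ∘ unzip)
      ∎
    where
    open ≡-Reasoning
    go : ∀ n {f : Vec Bool n × Vec Bool n → ℕ} →
         ∑ (tuples n two) (λ v → ∑ (tuples n two) (λ v′ → f (v , v′))) ≡ ∑ (tuples n four) (f ∘ unzip)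
    go zero    = +-identityʳ _
    go (suc n) {f} = begin
      ∑ (tuples (suc n) two) (λ v → ∑ (tuples (suc n) two) (λ v′ → f (v , v′)))
        ≡⟨ ∑-words two (replicate n two) ⟩
      ∑ two (λ a → ∑ (tuples n two) (λ v → ∑ (tuples (suc n) two) (λ v′ → f (a ∷ v , v′))))
        ≡⟨ ∑-cong two (λ a → trans (∑-cong (tuples n two) (λ v → ∑-words two (replicate n two) {λ v′ → f (a ∷ v , v′)}))
                                     (∑-comm {f = λ v b → ∑ (tuples n two) (λ v′ → f (a ∷ v , b ∷ v′))}
                                             (tuples n two) two)) ⟩
      ∑ two (λ a → ∑ two (λ b → ∑ (tuples n two) (λ v → ∑ (tuples n two) (λ v′ → f (a ∷ v , b ∷ v′)))))
        ≡⟨ ∑-cong two (λ a → ∑-cong two (λ b → go n {λ (v , v′) → f (a ∷ v , b ∷ v′)})) ⟩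
      ∑ two (λ a → ∑ two (λ b → ∑ (tuples n four) (λ w → f (unzip ((a , b) ∷ w)))))
        ≡⟨ sym (∑-× {f = λ s → ∑ (tuples n four) (λ w → f (unzip (s ∷ w)))} two two) ⟩
      ∑ four (λ s → ∑ (tuples n four) (λ w → f (unzip (s ∷ w))))
        ≡⟨ sym (∑-words four (replicate n four)) ⟩
      ∑ (tuples (suc n) four) (f ∘ unzip)
        ∎

  ∑-edgeSels : (m n : ℕ) {f : EdgeSel m n → ℕ} →
               ∑ (allEdgeSels m n) f ≡ ∑ (tuples m four) (λ w → ∑ (tuples n two) (λ v → f (unzip w , v)))
  ∑-edgeSels m n {f} =
    trans (∑-× {f = f} (cartesianProduct (allVec m) (allVec m)) (allVec n))
          (trans (∑-unzip m {λ E → ∑ (allVec n) (λ v → f (E , v))})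
                 (∑-cong (tuples m four) (λ w → ∑-allVec n {λ v → f (unzip w , v)})))

-- Conditions and permutations acting coordinatewise.

accepts : Vec (A → Bool) n → Vec A n → Bool
accepts []       []      = true
accepts (P ∷ Ps) (x ∷ w) = P x ∧ accepts Ps w

opaque
  unfolding ∑

  ∑-filter : (P : A → Bool) (xs : List A) {f : A → ℕ} → ∑ xs (λ x → bit (P x) * f x) ≡ ∑ (filterᵇ P xs) f
  ∑-filter P []       = refl
  ∑-filter P (x ∷ xs) {f} with P x
  ... | true  = cong₂ _+_ (*-identityˡ (f x)) (∑-filter P xs)
  ... | false = ∑-filter P xs

  -- This is how forced choices enter: a condition on each coordinate shrinks the letter lists
  -- themselves, so inadmissible samples are never enumerated.
  ∑-restrict : (Ps : Vec (A → Bool) n) (ls : Vec (List A) n) {f : Vec A n → ℕ} →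
               ∑ (words ls) (λ w → bit (accepts Ps w) * f w) ≡ ∑ (words (zipWith filterᵇ Ps ls)) f
  ∑-restrict []       []       {f} = cong (_+ 0) (*-identityˡ (f []))
  ∑-restrict (P ∷ Ps) (l ∷ ls) {f} = begin
    ∑ (words (l ∷ ls)) (λ w → bit (accepts (P ∷ Ps) w) * f w)
      ≡⟨ ∑-words l ls ⟩
    ∑ l (λ a → ∑ (words ls) (λ w → bit (P a ∧ accepts Ps w) * f (a ∷ w)))
      ≡⟨ ∑-cong l (λ a → trans (∑-cong (words ls) (λ w →
           trans (cong (_* f (a ∷ w)) (bit-∧ (P a) (accepts Ps w))) (*-assoc (bit (P a)) _ _)))
           (∑-* (bit (P a)) (words ls))) ⟩
    ∑ l (λ a → bit (P a) * ∑ (words ls) (λ w → bit (accepts Ps w) * f (a ∷ w)))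
      ≡⟨ ∑-cong l (λ a → cong (bit (P a) *_) (∑-restrict Ps ls)) ⟩
    ∑ l (λ a → bit (P a) * ∑ (words (zipWith filterᵇ Ps ls)) (λ w → f (a ∷ w)))
      ≡⟨ ∑-filter P l ⟩
    ∑ (filterᵇ P l) (λ a → ∑ (words (zipWith filterᵇ Ps ls)) (λ w → f (a ∷ w)))
      ≡⟨ sym (∑-words (filterᵇ P l) (zipWith filterᵇ Ps ls)) ⟩
    ∑ (words (zipWith filterᵇ (P ∷ Ps) (l ∷ ls))) f
      ∎
    where open ≡-Reasoning

  -- Each coordinate is moved by its own map, so invariance can be checked one letter list at a
  -- time. The maps used later are the exchange of levels and the identity.
  ∑-permute : (σs : Vec (A → A) n) (ls : Vec (List A) n) →
              (∀ i (f : A → ℕ) → ∑ (lookup ls i) (λ a → f (lookup σs i a)) ≡ ∑ (lookup ls i) f) →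
              (f : Vec A n → ℕ) → ∑ (words ls) (λ w → f (zipWith (λ σ a → σ a) σs w)) ≡ ∑ (words ls) f
  ∑-permute []       []       inv f = refl
  ∑-permute (σ ∷ σs) (l ∷ ls) inv f = begin
    ∑ (words (l ∷ ls)) (λ w → f (zipWith (λ σ a → σ a) (σ ∷ σs) w))
      ≡⟨ ∑-words l ls ⟩
    ∑ l (λ a → ∑ (words ls) (λ w → f (σ a ∷ zipWith (λ σ a → σ a) σs w)))
      ≡⟨ ∑-cong l (λ a → ∑-permute σs ls (inv ∘ suc) (λ w → f (σ a ∷ w))) ⟩
    ∑ l (λ a → ∑ (words ls) (λ w → f (σ a ∷ w)))
      ≡⟨ inv zero (λ a → ∑ (words ls) (λ w → f (a ∷ w))) ⟩
    ∑ l (λ a → ∑ (words ls) (λ w → f (a ∷ w)))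
      ≡⟨ sym (∑-words l ls) ⟩
    ∑ (words (l ∷ ls)) f
      ∎
    where open ≡-Reasoning

-- Deciding reachability

-- The Floyd–Warshall recursion: Via R zs x y says that some walk from x to y
-- has all its intermediate points in zs.
Via : (A → A → Set) → List A → A → A → Set
Via R []       x y = x ≡ y ⊎ R x y
Via R (z ∷ zs) x y = Via R zs x y ⊎ (Via R zs x z × Via R zs z y)

via? : {R : A → A → Set} → DecidableEquality A → Decidable R → ∀ zs → Decidable (Via R zs)
via? _≟_ R? []       x y = (x ≟ y) ⊎-dec R? x y
via? _≟_ R? (z ∷ zs) x y = via? _≟_ R? zs x y ⊎-dec (via? _≟_ R? zs x z ×-dec via? _≟_ R? zs z y)

via⇒star : {R : A → A → Set} (zs : List A) {x y : A} → Via R zs x y → Star R x y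
via⇒star []       (inj₁ refl)    = ε
via⇒star []       (inj₂ s)       = s ◅ ε
via⇒star (z ∷ zs) (inj₁ v)       = via⇒star zs v
via⇒star (z ∷ zs) (inj₂ (v , w)) = via⇒star zs v ◅◅ via⇒star zs w

via-direct : {R : A → A → Set} (zs : List A) {x y : A} → x ≡ y ⊎ R x y → Via R zs x y
via-direct []       d = d
via-direct (z ∷ zs) d = inj₁ (via-direct zs d)

-- If the walks are joined at the head of the list, the first is cut at its first visit there and
-- the second after its last. Otherwise, if both visit the head, the detour between these visits is
-- dropped.
via-trans : {R : A → A → Set} (zs : List A) {x y z : A} → z ∈ zs → Via R zs x z → Via R zs z y → Via R zs x y
via-trans {R = R} (w ∷ zs) {x} {y} (here refl) xz zy = inj₂ (left xz , right zy)
  where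
  left : Via R (w ∷ zs) x w → Via R zs x w
  left (inj₁ v)       = v
  left (inj₂ (v , _)) = v
  right : Via R (w ∷ zs) w y → Via R zs w y
  right (inj₁ v)       = v
  right (inj₂ (_ , v)) = v
via-trans (w ∷ zs) (there z∈) (inj₁ xz)        (inj₁ zy)        = inj₁ (via-trans zs z∈ xz zy)
via-trans (w ∷ zs) (there z∈) (inj₁ xz)        (inj₂ (zw , wy)) = inj₂ (via-trans zs z∈ xz zw , wy)
via-trans (w ∷ zs) (there z∈) (inj₂ (xw , wz)) (inj₁ zy)        = inj₂ (xw , via-trans zs z∈ wz zy)
via-trans (w ∷ zs) (there z∈) (inj₂ (xw , wz)) (inj₂ (zw , wy)) = inj₂ (xw , wy)

star⇒via : {R : A → A → Set} (zs : List A) → (∀ z → z ∈ zs) → ∀ {x y} → Star R x y → Via R zs x y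
star⇒via zs all∈ ε       = via-direct zs (inj₁ refl)
star⇒via zs all∈ (s ◅ t) = via-trans zs (all∈ _) (via-direct zs (inj₂ s)) (star⇒via zs all∈ t)

abstract
  -- Only the existence of a decision matters here, to make indicators meaningful. The recursion
  -- branches threefold at every point and must never be run, hence `abstract`; actual counts come
  -- from `tally`.
  star? : {R : A → A → Set} (zs : List A) → (∀ z → z ∈ zs) → DecidableEquality A → Decidable R → Decidable (Star R)
  star? zs all∈ _≟_ R? x y = map′ (via⇒star zs) (star⇒via zs all∈) (via? _≟_ R? zs x y)

bools : List Bool
bools = false ∷ true ∷ []

∈-bools : ∀ b → b ∈ bools
∈-bools false = here refl
∈-bools true  = there (here refl)

tvs : ∀ n → List (TV n)
tvs n = cartesianProduct (allFin n) bools

∈-tvs : (x : TV n) → x ∈ tvs n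
∈-tvs (a , i) = ∈-cartesianProduct⁺ (∈-allFin a) (∈-bools i)

_≟ᵛ_ : DecidableEquality (TV n)
_≟ᵛ_ = ×-≡-dec Finₚ._≟_ Boolₚ._≟_

-- A `Place` is a vertex before the bunkbed is formed, a site or a hub. In a `Node` only the sites
-- have two levels: the two copies of a hub are identified, being connected in every sample that is
-- compared with the core.
Place Node : ℕ → ℕ → Set
Place p q = Fin p ⊎ Fin q
Node  p q = TV p ⊎ Fin q

_≟ᵖ_ : DecidableEquality (Place p q)
_≟ᵖ_ = ⊎-≡-dec Finₚ._≟_ Finₚ._≟_

_≟ⁿ_ : DecidableEquality (Node p q)
_≟ⁿ_ = ⊎-≡-dec _≟ᵛ_ Finₚ._≟_

nodes : ∀ p q → List (Node p q)
nodes p q = map inj₁ (tvs p) ++ map inj₂ (allFin q)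

∈-nodes : (x : Node p q) → x ∈ nodes p q
∈-nodes         (inj₁ a) = ∈-++⁺ˡ (∈-map⁺ inj₁ (∈-tvs a))
∈-nodes {p} {q} (inj₂ h) = ∈-++⁺ʳ (map inj₁ (tvs p)) (∈-map⁺ inj₂ (∈-allFin h))

-- Saturation: computing sets of reachable nodes.

Rule : Set → Set
Rule A = List A × List A

Fires : List (Rule A) → A → A → Set
Fires ρs x y = Any (λ ρ → x ∈ proj₁ ρ × y ∈ proj₂ ρ) ρs

fires? : DecidableEquality A → (ρs : List (Rule A)) → Decidable (Fires ρs)
fires? _≟_ ρs x y = any? (λ ρ → any? (x ≟_) (proj₁ ρ) ×-dec any? (y ≟_) (proj₂ ρ)) ρs

siteAt : Fin p → Bool → Node p q
siteAt x i = inj₁ (x , i)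

reach? : (ρs : List (Rule (Node p q))) → Decidable (Star (Fires ρs))
reach? ρs = star? (nodes _ _) ∈-nodes _≟ⁿ_ (fires? _≟ⁿ_ ρs)

State : ℕ → ℕ → Set
State p q = Vec (Bool × Bool) p × Vec Bool q

get : State p q → Node p q → Bool
get S (inj₁ (x , l)) = layer l (lookup (proj₁ S) x)
get S (inj₂ h)       = lookup (proj₂ S) h

mark : State p q → Node p q → State p q
mark (S , T) (inj₁ (x , false)) = S [ x ]%= (λ s → true , proj₂ s) , T
mark (S , T) (inj₁ (x , true))  = S [ x ]%= (λ s → proj₁ s , true) , T
mark (S , T) (inj₂ h)           = S , T [ h ]≔ true

none : State p q
none = replicate _ (false , false) , replicate _ false

apply : State p q → Rule (Node p q) → State p q
apply S (is , os) = if any (get S) is then foldl mark S os else S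

closed : List (Rule (Node p q)) → State p q → Bool
closed ρs S = all (λ ρ → not (any (get S) (proj₁ ρ)) ∨ all (get S) (proj₂ ρ)) ρs

-- Within a round, later rules already see the marks of earlier ones. A state is returned only after
-- it has been tested to be closed, so no bound on the number of rounds has to be proved: too little
-- fuel gives `nothing`, and the evaluated counts would not check.
saturate : ℕ → List (Rule (Node p q)) → State p q → Maybe (State p q)
saturate zero    ρs S = nothing
saturate (suc k) ρs S = if closed ρs S then just S else saturate k ρs (foldl apply S ρs)

get-none : (x : Node p q) → get {p} {q} none x ≢ true
get-none (inj₁ (x , false)) e = contradiction (trans (sym e) (cong proj₁ (Vecₚ.lookup-replicate x _))) λ ()
get-none (inj₁ (x , true))  e = contradiction (trans (sym e) (cong proj₂ (Vecₚ.lookup-replicate x _))) λ ()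
get-none (inj₂ h)           e = contradiction (trans (sym e) (Vecₚ.lookup-replicate h _)) λ ()

get-mark : (S : State p q) (x y : Node p q) → get (mark S x) y ≡ true → x ≡ y ⊎ get S y ≡ true
get-mark (S , T) (inj₁ (a , i)) (inj₂ h) e with i
... | false = inj₂ e
... | true  = inj₂ e
get-mark (S , T) (inj₂ h) (inj₁ a) e = inj₂ e
get-mark (S , T) (inj₂ h) (inj₂ h′) e with h Finₚ.≟ h′
... | yes refl = inj₁ refl
... | no h≢h′  = inj₂ (trans (sym (Vecₚ.lookup∘update′ (h≢h′ ∘ sym) T true)) e)
get-mark (S , T) (inj₁ (a , i)) (inj₁ (b , j)) e with a Finₚ.≟ b
get-mark (S , T) (inj₁ (a , false)) (inj₁ (b , j)) e | no a≢b =
  inj₂ (trans (cong (layer j) (sym (Vecₚ.lookup∘updateAt′ b a (a≢b ∘ sym) S))) e)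
get-mark (S , T) (inj₁ (a , true)) (inj₁ (b , j)) e | no a≢b =
  inj₂ (trans (cong (layer j) (sym (Vecₚ.lookup∘updateAt′ b a (a≢b ∘ sym) S))) e)
get-mark (S , T) (inj₁ (a , false)) (inj₁ (b , false)) e | yes refl = inj₁ refl
get-mark (S , T) (inj₁ (a , true))  (inj₁ (b , true))  e | yes refl = inj₁ refl
get-mark (S , T) (inj₁ (a , false)) (inj₁ (b , true))  e | yes refl =
  inj₂ (trans (cong proj₂ (sym (Vecₚ.lookup∘updateAt a S))) e)
get-mark (S , T) (inj₁ (a , true))  (inj₁ (b , false)) e | yes refl =
  inj₂ (trans (cong proj₁ (sym (Vecₚ.lookup∘updateAt a S))) e)

any-true : (P : A → Bool) (xs : List A) → any P xs ≡ true → ∃ λ x → x ∈ xs × P x ≡ true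
any-true P (x ∷ xs) e with P x in eq
... | true  = x , here refl , eq
... | false with any-true P xs e
...   | y , y∈ , e′ = y , there y∈ , e′

any-false : (P : A → Bool) (xs : List A) → any P xs ≡ false → ∀ {x} → x ∈ xs → P x ≡ false
any-false P (x ∷ xs) e (here refl) with P x
... | false = refl
any-false P (x ∷ xs) e (there x∈) with P x
... | false = any-false P xs e x∈

all-true : (P : A → Bool) (xs : List A) → all P xs ≡ true → ∀ {x} → x ∈ xs → P x ≡ true
all-true P (x ∷ xs) e (here refl) with P x
... | true = refl
all-true P (x ∷ xs) e (there x∈) with P x
... | true = all-true P xs e x∈

module _ {R : Node p q → Node p q → Set} (u : Node p q) where

  Sound : State p q → Set
  Sound S = ∀ x → get S x ≡ true → Star R u x

  foldl-mark : (os : List (Node p q)) {S : State p q} → Sound S → (∀ {y} → y ∈ os → Star R u y) →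
               Sound (foldl mark S os)
  foldl-mark []       sound new = sound
  foldl-mark (o ∷ os) {S} sound new = foldl-mark os step (new ∘ there)
    where
    step : Sound (mark S o)
    step x e with get-mark S o x e
    ... | inj₁ refl = new (here refl)
    ... | inj₂ e′   = sound x e′

  apply-sound : (ρ : Rule (Node p q)) {S : State p q} → (∀ {x y} → x ∈ proj₁ ρ → y ∈ proj₂ ρ → R x y) →
                Sound S → Sound (apply S ρ)
  apply-sound (is , os) {S} edge sound with any (get S) is in eq
  ... | false = sound
  ... | true with any-true (get S) is eq
  ...   | x , x∈ , e = foldl-mark os sound (λ y∈ → sound x e ◅◅ (edge x∈ y∈ ◅ ε))

  foldl-apply : (ρs : List (Rule (Node p q))) {S : State p q} → (∀ {x y} → Fires ρs x y → R x y) →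
                Sound S → Sound (foldl apply S ρs)
  foldl-apply []       edge sound = sound
  foldl-apply (ρ ∷ ρs) edge sound =
    foldl-apply ρs (edge ∘ there) (apply-sound ρ (λ x∈ y∈ → edge (here (x∈ , y∈))) sound)

closed-step : (ρs : List (Rule (Node p q))) (S : State p q) → closed ρs S ≡ true →
              ∀ {x y} → Fires ρs x y → get S x ≡ true → get S y ≡ true
closed-step (ρ ∷ ρs) S c (there f) e with not (any (get S) (proj₁ ρ)) ∨ all (get S) (proj₂ ρ)
... | true = closed-step ρs S c f e
closed-step (ρ ∷ ρs) S c (here (x∈ , y∈)) e with any (get S) (proj₁ ρ) in eq
... | false = contradiction (trans (sym e) (any-false (get S) (proj₁ ρ) eq x∈)) λ ()
... | true with all (get S) (proj₂ ρ) in eq′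
...   | true = all-true (get S) (proj₂ ρ) eq′ y∈

closed-star : (ρs : List (Rule (Node p q))) (S : State p q) → closed ρs S ≡ true →
              ∀ {x y} → Star (Fires ρs) x y → get S x ≡ true → get S y ≡ true
closed-star ρs S c ε       e = e
closed-star ρs S c (f ◅ s) e = closed-star ρs S c s (closed-step ρs S c f e)

saturate-sound : (k : ℕ) (ρs : List (Rule (Node p q))) (u : Node p q) {S S′ : State p q} →
                 saturate k ρs S ≡ just S′ → Sound {R = Fires ρs} u S →
                 Sound {R = Fires ρs} u S′ × closed ρs S′ ≡ true
saturate-sound (suc k) ρs u {S} e sound with closed ρs S in eq
saturate-sound (suc k) ρs u {S} refl sound | true = sound , eq
... | false = saturate-sound k ρs u e (foldl-apply u ρs (λ f → f) sound)

-- One saturation serves both targets. The test `get S u` takes the place of a proof that marks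
-- survive later rounds.
tally : ℕ → (A → List (Rule (Node p q))) → (u v w : Node p q) → List A → Maybe (ℕ × ℕ)
tally k ρs u v w []       = just (0 , 0)
tally k ρs u v w (c ∷ cs) with saturate k (ρs c) (mark none u) | tally k ρs u v w cs
... | just S | just (a , b) =
  if get S u then just (bit (get S v) + a , bit (get S w) + b) else nothing
... | _      | _            = nothing

opaque
  unfolding ∑

  -- A marked node is reachable because every mark has a cause; a reachable node is marked because
  -- the final state is closed and contains `u`. Thus the computed bit agrees with the abstract
  -- decision `reach?`.
  tally-sound : (k : ℕ) (ρs : A → List (Rule (Node p q))) (u v w : Node p q) (cs : List A) {a b : ℕ} →
                tally k ρs u v w cs ≡ just (a , b) →
                ∑ cs (λ c → ind (reach? (ρs c) u v)) ≡ a × ∑ cs (λ c → ind (reach? (ρs c) u w)) ≡ b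
  tally-sound k ρs u v w [] refl = refl , refl
  tally-sound k ρs u v w (c ∷ cs) e
    with saturate k (ρs c) (mark none u) in eq | tally k ρs u v w cs in eq′
  ... | just S | just (a , b) with get S u in eqᵤ
  tally-sound k ρs u v w (c ∷ cs) refl | just S | just (a , b) | true =
    cong₂ _+_ (hit v) (proj₁ rest) , cong₂ _+_ (hit w) (proj₂ rest)
    where
    rest : ∑ cs (λ c → ind (reach? (ρs c) u v)) ≡ a × ∑ cs (λ c → ind (reach? (ρs c) u w)) ≡ b
    rest = tally-sound k ρs u v w cs eq′
    start : Sound {R = Fires (ρs c)} u (mark none u)
    start x e with get-mark none u x e
    ... | inj₁ refl = ε
    ... | inj₂ e′   = contradiction e′ (get-none x)
    final : Sound {R = Fires (ρs c)} u S × closed (ρs c) S ≡ true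
    final = saturate-sound k (ρs c) u eq start
    hit : ∀ x → ind (reach? (ρs c) u x) ≡ bit (get S x)
    hit x with reach? (ρs c) u x | get S x in eqₓ
    ... | yes s | true  = refl
    ... | no ¬s | false = refl
    ... | no ¬s | true  = contradiction (proj₁ final x eqₓ) ¬s
    ... | yes s | false = contradiction (trans (sym eqₓ) (closed-star (ρs c) S (proj₂ final) s eqᵤ)) λ ()

-- The two maps are not inverse to each other: one collapses copies, the other chooses
-- representatives. They only have to match at the endpoints.
star-⇔ : {R : A → A → Set} {S : B → B → Set} (f : A → B) (g : B → A) →
         (∀ {x y} → R x y → Star S (f x) (f y)) → (∀ {x y} → S x y → Star R (g x) (g y)) →
         ∀ {u v a b} → f u ≡ a → f v ≡ b → g a ≡ u → g b ≡ v → Star R u v ⇔ Star S a b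
star-⇔ f g R⇒S S⇒R refl refl gu gv =
  mk⇔ (kleisliStar f R⇒S) (λ s → subst₂ (Star _) gu gv (kleisliStar g S⇒R s))

does-true : {P : Set} (d : Dec P) → does d ≡ true → P
does-true (yes p) e = p

-- Site percolation

-- Vertices of a blow-up: p simple vertices and r copies of each of the q hubs.
place : Fin (p + q * r) → Place p q
place {p} {q} {r} a = Sum.map₂ (quotient {q} r) (splitAt p a)

spot : (Fin q → Fin r) → Place p q → Fin (p + q * r)
spot {q} {r}     j (inj₁ x) = x ↑ˡ (q * r)
spot {p = p}     j (inj₂ h) = p ↑ʳ combine h (j h)

place-combine : (h : Fin q) (j : Fin r) → place {p} {q} {r} (p ↑ʳ combine h j) ≡ inj₂ h
place-combine {q} {r} {p} h j =
  trans (cong (Sum.map₂ (quotient {q} r)) (Finₚ.splitAt-↑ʳ p (q * r) (combine h j)))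
        (cong (inj₂ ∘ proj₁) (Finₚ.remQuot-combine {q} {r} h j))

place-spot : (j : Fin q → Fin r) (a : Place p q) → place {p} {q} {r} (spot j a) ≡ a
place-spot {q} {r} {p} j (inj₁ x) = cong (Sum.map₂ (quotient {q} r)) (Finₚ.splitAt-↑ˡ p x (q * r))
place-spot {q} {r} {p} j (inj₂ h) = place-combine h (j h)

place-inj₁ : (a : Fin (p + q * r)) {x : Fin p} → place {p} {q} {r} a ≡ inj₁ x → a ≡ x ↑ˡ (q * r)
place-inj₁ {p} {q} {r} a e with splitAt p a in eq
place-inj₁ {p} {q} {r} a refl | inj₁ x = sym (Finₚ.splitAt⁻¹-↑ˡ eq)

lookup-group : (c : Vec A p) (ws : Vec (Vec A r) q) (h : Fin q) (j : Fin r) →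
               lookup (c Vec.++ Vec.concat ws) (p ↑ʳ combine h j) ≡ lookup (lookup ws h) j
lookup-group c ws h j = trans (Vecₚ.lookup-++ʳ c (Vec.concat ws) (combine h j)) (Vecₚ.lookup-concat ws h j)

-- The `q` groups are independent, and a group fails only if all its `r` members miss `P`.
∑-groups : (P : A → Bool) (q r : ℕ) (l : List A) →
           ∑ (tuples q (tuples r l)) (bit ∘ every (some P)) ≡ (size l ^ r ∸ ∑ l (bit ∘ not ∘ P) ^ r) ^ q
∑-groups P q r l =
  trans (∑-every (some P) q (tuples r l))
        (cong (_^ q) (sym (trans (cong (_∸ ∑ l (bit ∘ not ∘ P) ^ r) (sym (∑-some P r l)))
                                 (m+n∸n≡m _ (∑ l (bit ∘ not ∘ P) ^ r)))))

size-groups : (q r : ℕ) (l : List A) → size (tuples q (tuples r l)) ≡ (size l ^ r) ^ q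
size-groups q r l = trans (size-tuples q (tuples r l)) (cong (_^ q) (size-tuples r l))

pick : (P : A → Bool) (ws : Vec (Vec A r) q) → every (some P) ws ≡ true →
       Σ (Fin q → Fin r) λ j → ∀ h → P (lookup (lookup ws h) (j h)) ≡ true
pick P ws e = (λ h → proj₁ (hit h)) , (λ h → proj₂ (hit h))
  where
  hit : ∀ h → ∃ λ j → P (lookup (lookup ws h) j) ≡ true
  hit h = some-lookup P (lookup ws h) (every-lookup (some P) ws e h)

lift : Bool → Place p q → Node p q
lift l (inj₁ x) = inj₁ (x , l)
lift l (inj₂ h) = inj₂ h

guard : Bool → A → List A
guard b x = if b then [ x ] else []

guard⁺ : {P : A → Set} {b : Bool} {x : A} → b ≡ true → P x → Any P (guard b x)
guard⁺ refl px = here px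

guard⁻ : {P : A → Set} (b : Bool) {x : A} → Any P (guard b x) → b ≡ true × P x
guard⁻ true (here px) = refl , px

∧-true : ∀ {x y} → x ∧ y ≡ true → x ≡ true × y ≡ true
∧-true {true} e = refl , e

ends : Fin p → List (Node p q)
ends x = inj₁ (x , false) ∷ inj₁ (x , true) ∷ []

vertRule : Vec Bool p → Fin p → List (Rule (Node p q))
vertRule v x = guard (lookup v x) (ends x , ends x)

vertRules : Vec Bool p → List (Rule (Node p q))
vertRules v = concatMap (vertRule v) (allFin _)

end∈ : (x : Fin p) (i : Bool) → inj₁ (x , i) ∈ ends {q = q} x
end∈ x false = here refl
end∈ x true  = there (here refl)

vert⁺ : (v : Vec Bool p) {x : Fin p} (i j : Bool) → lookup v x ≡ true →
        Fires {Node p q} (vertRules v) (inj₁ (x , i)) (inj₁ (x , j))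
vert⁺ v {x} i j e = concatMap⁺ (vertRule v) (lose (∈-allFin x) (guard⁺ e (end∈ x i , end∈ x j)))

vert⁻ : (v : Vec Bool p) {a b : Node p q} → Fires (vertRules v) a b →
        ∃ λ x → lookup v x ≡ true × ∃ λ i → ∃ λ j → a ≡ inj₁ (x , i) × b ≡ inj₁ (x , j)
vert⁻ v f with find (concatMap⁻ (vertRule v) {xs = allFin _} f)
... | x , _ , g with guard⁻ (lookup v x) g
...   | e , a∈ , b∈ = x , e , proj₁ (level a∈) , proj₁ (level b∈) , proj₂ (level a∈) , proj₂ (level b∈)
  where
  level : ∀ {a} → a ∈ ends x → ∃ λ i → a ≡ inj₁ (x , i)
  level (here refl)         = false , refl
  level (there (here refl)) = true , refl

-- Hubs count as open on both levels, since the core models only samples in which each hub has a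
-- copy that is open twice.
openAt : Vec Letter p → Bool → Place p q → Bool
openAt c l (inj₁ x) = layer l (lookup c x)
openAt c l (inj₂ h) = true

edgeRule : Vec Letter p → Place p q × Place p q → Bool → List (Rule (Node p q))
edgeRule c (x , y) l =
  guard (openAt c l x ∧ openAt c l y) (lift l x ∷ lift l y ∷ [] , lift l x ∷ lift l y ∷ [])

siteRules : List (Place p q × Place p q) → Vec Letter p → List (Rule (Node p q))
siteRules es c =
  concatMap (λ e → concatMap (edgeRule c e) bools) es
  ++ vertRules (Vec.map (λ s → proj₁ s ∧ proj₂ s) c)

lookup-both : (c : Vec Letter p) (x : Fin p) → lookup (Vec.map (λ s → proj₁ s ∧ proj₂ s) c) x ≡ true →
              ∀ i → layer i (lookup c x) ≡ true
lookup-both c x e false = proj₁ (∧-true {proj₁ (lookup c x)} (trans (sym (Vecₚ.lookup-map x _ c)) e))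
lookup-both c x e true  = proj₂ (∧-true {proj₁ (lookup c x)} (trans (sym (Vecₚ.lookup-map x _ c)) e))

module Sites (es : List (Place p q × Place p q)) (r : ℕ) where

  N : ℕ
  N = p + q * r

  Adj : Place p q → Place p q → Set
  Adj x y = Any (λ e → e ≡ (x , y) ⊎ e ≡ (y , x)) es

  adj? : Decidable Adj
  adj? x y = any? (λ e → (×-≡-dec _≟ᵖ_ _≟ᵖ_ e (x , y)) ⊎-dec (×-≡-dec _≟ᵖ_ _≟ᵖ_ e (y , x))) es

  graph : All (λ e → proj₁ e ≢ proj₂ e) es → SimpleGraph N
  graph distinct = record
    { adj    = λ a b → does (adj? (place {p} {q} {r} a) (place {p} {q} {r} b))
    ; sym    = λ a b → does-⇔ (mk⇔ (Any.map Sum.swap) (Any.map Sum.swap)) (adj? _ _) (adj? _ _)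
    ; irrefl = λ a → dec-false (adj? _ _) (loop (place {p} {q} {r} a))
    }
    where
    loop : ∀ x → ¬ Adj x x
    loop x e with find e
    ... | _ , e∈ , inj₁ refl = All.lookup distinct e∈ refl
    ... | _ , e∈ , inj₂ refl = All.lookup distinct e∈ refl

  module _ (distinct : All (λ e → proj₁ e ≢ proj₂ e) es)
           (c : Vec Letter p) (ws : Vec (Vec Letter r) q)
           (j : Fin q → Fin r) (good : ∀ h → lookup (lookup ws h) (j h) ≡ (true , true)) where

    private
      U : OpenSet N
      U = unzip (c Vec.++ Vec.concat ws)

      Step : TV N → TV N → Set
      Step = SiteStep (graph distinct) U

      node : TV N → Node p q
      node (a , i) = lift i (place {p} {q} {r} a)

      real : Node p q → TV N
      real (inj₁ (x , i)) = spot j (inj₁ x) , i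
      real (inj₂ h)       = spot j (inj₂ h) , false

      open-site : ∀ x i → isOpen U (spot {q} {r} j (inj₁ x) , i) ≡ layer i (lookup c x)
      open-site x i = trans (lookup-unzip (c Vec.++ Vec.concat ws) i (x ↑ˡ (q * r)))
                            (cong (layer i) (Vecₚ.lookup-++ˡ c (Vec.concat ws) x))

      open-hub : ∀ h i → isOpen U (spot {q} {r} {p} j (inj₂ h) , i) ≡ true
      open-hub h i = trans (lookup-unzip (c Vec.++ Vec.concat ws) i (p ↑ʳ combine h (j h)))
                           (trans (cong (layer i) (trans (lookup-group c ws h (j h)) (good h))) (layer-true i))
        where
        layer-true : ∀ i → layer i (true , true) ≡ true
        layer-true false = refl
        layer-true true  = refl

      open-place : ∀ a i → isOpen U (a , i) ≡ true → openAt c i (place {p} {q} {r} a) ≡ true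
      open-place a i e with place {p} {q} {r} a in eq
      ... | inj₂ h = refl
      ... | inj₁ x rewrite place-inj₁ {p} {q} {r} a eq = trans (sym (open-site x i)) e

      open-spot : ∀ x i → openAt c i x ≡ true → isOpen U (spot j x , i) ≡ true
      open-spot (inj₁ x) i e = trans (open-site x i) e
      open-spot (inj₂ h) i e = open-hub h i

      -- All copies of a hub go to the same node, so a copy that is open on one level only cannot
      -- connect more than the chosen copy does, and vertical steps at hubs become empty.
      forward : ∀ {x y} → Step x y → Star (Fires (siteRules es c)) (node x) (node y)
      forward (horiz {a} {b} {i} e oa ob) with find (does-true (adj? _ _) e)
      ... | (x , y) , e∈ , d =
        ++⁺ˡ (concatMap⁺ (λ e → concatMap (edgeRule c e) bools)
          (lose e∈ (concatMap⁺ (edgeRule c (x , y)) (lose (∈-bools i) (fire d))))) ◅ ε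
        where
        fire : ∀ {x y} → (x , y) ≡ (place {p} {q} {r} a , place {p} {q} {r} b) ⊎
                         (x , y) ≡ (place {p} {q} {r} b , place {p} {q} {r} a) →
               Fires (edgeRule c (x , y) i) (node (a , i)) (node (b , i))
        fire (inj₁ refl) = guard⁺ (cong₂ _∧_ (open-place a i oa) (open-place b i ob)) (here refl , there (here refl))
        fire (inj₂ refl) = guard⁺ (cong₂ _∧_ (open-place b i ob) (open-place a i oa)) (there (here refl) , here refl)
      forward (vert {a} {i} o o′) with place {p} {q} {r} a in eq
      ... | inj₂ h = ε
      ... | inj₁ x rewrite place-inj₁ {p} {q} {r} a eq =
        ++⁺ʳ _ (vert⁺ (Vec.map (λ s → proj₁ s ∧ proj₂ s) c) i (not i)
          (trans (Vecₚ.lookup-map x _ c)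
                 (both-open i (trans (sym (open-site x i)) o) (trans (sym (open-site x (not i))) o′)))) ◅ ε
        where
        both-open : ∀ i → layer i (lookup c x) ≡ true → layer (not i) (lookup c x) ≡ true →
                    proj₁ (lookup c x) ∧ proj₂ (lookup c x) ≡ true
        both-open false e e′ = cong₂ _∧_ e e′
        both-open true  e e′ = cong₂ _∧_ e′ e

      -- A hub node is represented by the lower vertex of its chosen copy. A move on the upper level
      -- therefore starts or ends by crossing the vertical edge there.
      descend : ∀ l x → Star Step (real (lift l x)) (spot j x , l)
      descend l     (inj₁ x) = ε
      descend false (inj₂ h) = ε
      descend true  (inj₂ h) = vert (open-hub h false) (open-hub h true) ◅ ε

      ascend : ∀ l x → Star Step (spot j x , l) (real (lift l x))
      ascend l     (inj₁ x) = ε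
      ascend false (inj₂ h) = ε
      ascend true  (inj₂ h) = vert (open-hub h true) (open-hub h false) ◅ ε

      adjacent : ∀ {x y l} → Adj x y → openAt c l x ≡ true → openAt c l y ≡ true →
                 Star Step (real (lift l x)) (real (lift l y))
      adjacent {x} {y} {l} e ox oy =
        descend l x ◅◅ horiz (dec-true (adj? _ _) (subst₂ Adj (sym (place-spot {q} {r} j x)) (sym (place-spot {q} {r} j y)) e))
                             (open-spot x l ox) (open-spot y l oy) ◅ ascend l y

      backward : ∀ {x y} → Fires (siteRules es c) x y → Star Step (real x) (real y)
      backward f with ++⁻ (concatMap (λ e → concatMap (edgeRule c e) bools) es) f
      ... | inj₂ g with vert⁻ (Vec.map (λ s → proj₁ s ∧ proj₂ s) c) g
      ...   | x , e , i , i′ , refl , refl = levels i i′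
        where
        cross : ∀ i → Step (spot j (inj₁ x) , i) (spot j (inj₁ x) , not i)
        cross i = vert (trans (open-site x i) (lookup-both c x e i)) (trans (open-site x (not i)) (lookup-both c x e (not i)))
        levels : ∀ i i′ → Star Step (spot j (inj₁ x) , i) (spot j (inj₁ x) , i′)
        levels false false = ε
        levels false true  = cross false ◅ ε
        levels true  false = cross true ◅ ε
        levels true  true  = ε
      backward f | inj₁ g with find (concatMap⁻ (λ e → concatMap (edgeRule c e) bools) g)
      ... | (x , y) , e∈ , g′ with find (concatMap⁻ (edgeRule c (x , y)) {xs = bools} g′)
      ...   | l , _ , g″ with guard⁻ (openAt c l x ∧ openAt c l y) g″
      ...     | o , a∈ , b∈ with ∧-true o
      ...       | ox , oy = step a∈ b∈
        where
        step : ∀ {a b} → a ∈ lift l x ∷ lift l y ∷ [] → b ∈ lift l x ∷ lift l y ∷ [] → Star Step (real a) (real b)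
        step (here refl)         (here refl)         = ε
        step (there (here refl)) (there (here refl)) = ε
        step (here refl)         (there (here refl)) = adjacent (lose e∈ (inj₁ refl)) ox oy
        step (there (here refl)) (here refl)         = adjacent (lose e∈ (inj₂ refl)) oy ox

    site-reach : ∀ {x y i i′} → Star Step (x ↑ˡ (q * r) , i) (y ↑ˡ (q * r) , i′) ⇔
                                Star (Fires (siteRules es c)) (inj₁ (x , i)) (inj₁ (y , i′))
    site-reach {x} {y} {i} {i′} =
      star-⇔ node real forward backward
             (cong (lift i) (place-spot {q} {r} j (inj₁ x))) (cong (lift i′) (place-spot {q} {r} j (inj₁ y))) refl refl

siteStep? : (G : SimpleGraph n) (U : OpenSet n) → Decidable (SiteStep G U)
siteStep? G U (a , i) (b , j) = map′ to from
  ((i Boolₚ.≟ j ×-dec SimpleGraph.adj G a b Boolₚ.≟ true ×-dec isOpen U (a , i) Boolₚ.≟ true ×-dec isOpen U (b , i) Boolₚ.≟ true)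
   ⊎-dec (a Finₚ.≟ b ×-dec j Boolₚ.≟ not i ×-dec isOpen U (a , i) Boolₚ.≟ true ×-dec isOpen U (a , not i) Boolₚ.≟ true))
  where
  to : _ → SiteStep G U (a , i) (b , j)
  to (inj₁ (refl , e , o , o′)) = horiz e o o′
  to (inj₂ (refl , refl , o , o′)) = vert o o′
  from : SiteStep G U (a , i) (b , j) → _
  from (horiz e o o′) = inj₁ (refl , e , o , o′)
  from (vert o o′) = inj₂ (refl , refl , o , o′)

site? : (G : SimpleGraph n) (x y : TV n) (U : OpenSet n) → Dec (Star (SiteStep G U) x y)
site? G x y U = star? (tvs _) ∈-tvs _≟ᵛ_ (siteStep? G U) x y

fits : Bool → Letter → Bool
fits true  (x , y) = x ∧ y
fits false (x , y) = x xor y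

accepts-⇔ : (Ps : Vec (A → Bool) n) (w : Vec A n) →
            accepts Ps w ≡ true ⇔ (∀ i → lookup Ps i (lookup w i) ≡ true)
accepts-⇔ Ps w = mk⇔ (to Ps w) (from Ps w)
  where
  to : ∀ {n} (Ps : Vec (_ → Bool) n) w → accepts Ps w ≡ true → ∀ i → lookup Ps i (lookup w i) ≡ true
  to (P ∷ Ps) (x ∷ w) e zero    = proj₁ (∧-true e)
  to (P ∷ Ps) (x ∷ w) e (suc i) = to Ps w (proj₂ (∧-true {P x} e)) i
  from : ∀ {n} (Ps : Vec (_ → Bool) n) w → (∀ i → lookup Ps i (lookup w i) ≡ true) → accepts Ps w ≡ true
  from []       []      e = refl
  from (P ∷ Ps) (x ∷ w) e = cong₂ _∧_ (e zero) (from Ps w (e ∘ suc))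

fits-⇔ : ∀ t x y → fits t (x , y) ≡ true ⇔
                   ((t ≡ true → x ≡ true × y ≡ true) × (t ≡ false → x ≡ not y))
fits-⇔ true  true  y     = mk⇔ (λ e → (λ _ → refl , e) , λ ()) (λ (f , _) → proj₂ (f refl))
fits-⇔ true  false y     = mk⇔ (λ ()) (λ (f , _) → proj₁ (f refl))
fits-⇔ false true  true  = mk⇔ (λ ()) (λ (_ , g) → sym (g refl))
fits-⇔ false true  false = mk⇔ (λ e → (λ ()) , λ _ → refl) (λ _ → refl)
fits-⇔ false false true  = mk⇔ (λ e → (λ ()) , λ _ → refl) (λ _ → refl)
fits-⇔ false false false = mk⇔ (λ ()) (λ (_ , g) → g refl)

fitting : Vec Bool n → Vec (Letter → Bool) n
fitting = Vec.map fits

fitting-⇔ : (T : Vec Bool n) (w : Vec Letter n) → E2-Valid T (unzip w) ⇔ accepts (fitting T) w ≡ true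
fitting-⇔ T w = mk⇔
  (λ v → Equivalence.from (accepts-⇔ (fitting T) w) (λ i →
     trans (cong (λ P → P (lookup w i)) (Vecₚ.lookup-map i fits T))
           (Equivalence.from (fits-⇔ (lookup T i) _ _) (subst₂ (Fits i) (lookup-unzip w false i) (lookup-unzip w true i) (v i)))))
  (λ e i → subst₂ (Fits i) (sym (lookup-unzip w false i)) (sym (lookup-unzip w true i))
     (Equivalence.to (fits-⇔ (lookup T i) _ _)
       (trans (cong (λ P → P (lookup w i)) (sym (Vecₚ.lookup-map i fits T)))
              (Equivalence.to (accepts-⇔ (fitting T) w) e i))))
  where
  Fits : Fin _ → Bool → Bool → Set
  Fits i x y = (lookup T i ≡ true → x ≡ true × y ≡ true) × (lookup T i ≡ false → x ≡ not y)

fitting? : (T : Vec Bool n) (U : OpenSet n) → Dec (E2-Valid T U)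
fitting? T (lo , up) = Finₚ.all? (λ a →
  (lookup T a Boolₚ.≟ true →-dec (lookup lo a Boolₚ.≟ true ×-dec lookup up a Boolₚ.≟ true)) ×-dec
  (lookup T a Boolₚ.≟ false →-dec lookup lo a Boolₚ.≟ not (lookup up a)))

ind-bit : {P : Set} (d : Dec P) {b : Bool} → P ⇔ b ≡ true → ind d ≡ bit b
ind-bit (yes p) e = cong bit (sym (Equivalence.to e p))
ind-bit (no ¬p) {false} e = refl
ind-bit (no ¬p) {true}  e = contradiction (Equivalence.from e refl) ¬p

-- The path with three hubs: models E₁ and E₂.

hubOf : Fin 6 → Fin 3
hubOf 0F = 0F
hubOf 1F = 1F
hubOf 2F = 0F
hubOf 3F = 2F
hubOf 4F = 1F
hubOf 5F = 2F

siteEdges : List (Place 6 3 × Place 6 3)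
siteEdges = map (λ x → inj₁ (inject₁ x) , inj₁ (suc x)) (allFin 5) ++ map (λ x → inj₁ x , inj₂ (hubOf x)) (allFin 6)

siteEdges-distinct : All (λ e → proj₁ e ≢ proj₂ e) siteEdges
siteEdges-distinct = from-yes (All.all? (λ e → ¬? (proj₁ e ≟ᵖ proj₂ e)) siteEdges)

bothOpen : Letter → Bool
bothOpen s = proj₁ s ∧ proj₂ s

bothOpen-true : ∀ {s} → bothOpen s ≡ true → s ≡ (true , true)
bothOpen-true e = cong₂ _,_ (proj₁ (∧-true e)) (proj₂ (∧-true e))

<-tally : {a b a′ b′ : ℕ} → a′ ≡ a × b′ ≡ b → a < b → a′ < b′
<-tally (refl , refl) lt = lt

opaque
  unfolding ∑

  size-four : size four ≡ 4
  size-four = refl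

  misses-four : ∑ four (bit ∘ not ∘ bothOpen) ≡ 3
  misses-four = refl

opaque
  -- An evaluation over 4⁶ words on a core of 15 nodes, sealed so that it is not repeated where the
  -- result is used. The fuel 10 is generous.
  site-counts : tally {p = 6} {q = 3} 10 (siteRules siteEdges) (siteAt 0F false) (siteAt 5F false) (siteAt 5F true)
                      (tuples 6 four) ≡ just (703 , 704)
  site-counts = refl

site-oneOf-counts : tally {p = 6} {q = 3} 10 (siteRules siteEdges) (siteAt 0F false) (siteAt 5F false) (siteAt 5F true)
                          (tuples 6 oneOf) ≡ just (12 , 13)
site-oneOf-counts = refl

module _ (r : ℕ) where
  open Sites siteEdges r

  siteGraph : SimpleGraph N
  siteGraph = graph siteEdges-distinct

  -- The hypothesis says that some hub lacks a copy open on both levels with probability below 1/(4⁶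
  -- + 1). With `r` a variable, the argument is checked without expanding the large graph, and a
  -- numerical inequality remains.
  E1-less : 4 ^ 6 * (4 ^ r) ^ 3 < suc (4 ^ 6) * (4 ^ r ∸ 3 ^ r) ^ 3 → E1-PrLess siteGraph 0F 5F
  E1-less few =
    prLess (λ _ → yes tt) (site? siteGraph (0F , false) (5F , false)) (site? siteGraph (0F , false) (5F , true))
      (subst₂ _<_ (total (5F , false)) (total (5F , true))
        (thicken {P = count (5F , false)} {Q = count (5F , true)} (every (some bothOpen))
          (λ c ws → ind≤1 (site? siteGraph (0F , false) (5F , false) (unzip (c Vec.++ Vec.concat ws))))
          same
          (<-tally (tally-sound 10 (siteRules siteEdges) (siteAt 0F false) (siteAt 5F false) (siteAt 5F true)
                                (tuples 6 four) site-counts) (n<1+n 703))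
          few′))
    where
    sizeC : size (tuples 6 four) ≡ 4 ^ 6
    sizeC = trans (size-tuples 6 four) (cong (_^ 6) size-four)
    sizeW : size (tuples 3 (tuples r four)) ≡ (4 ^ r) ^ 3
    sizeW = trans (size-groups 3 r four) (cong (λ s → (s ^ r) ^ 3) size-four)
    goodW : ∑ (tuples 3 (tuples r four)) (bit ∘ every (some bothOpen)) ≡ (4 ^ r ∸ 3 ^ r) ^ 3
    goodW = trans (∑-groups bothOpen 3 r four) (cong₂ (λ s t → (s ^ r ∸ t ^ r) ^ 3) size-four misses-four)
    few′ : size (tuples 6 four) * size (tuples 3 (tuples r four)) <
           suc (size (tuples 6 four)) * ∑ (tuples 3 (tuples r four)) (bit ∘ every (some bothOpen))
    few′ = subst₂ _<_ (cong₂ _*_ (sym sizeC) (sym sizeW)) (cong₂ (λ x y → suc x * y) (sym sizeC) (sym goodW)) few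
    count : TV N → Vec Letter 6 → Vec (Vec Letter r) 3 → ℕ
    count y c ws = ind (site? siteGraph (0F , false) y (unzip (c Vec.++ Vec.concat ws)))
    same : ∀ c ws → every (some bothOpen) ws ≡ true → _ × _
    same c ws e with pick bothOpen ws e
    ... | j , good = one false , one true
      where
      one : ∀ i → count (5F , i) c ws ≡ ind (reach? (siteRules siteEdges c) (siteAt 0F false) (siteAt 5F i))
      one i = ind-⇔ (site-reach siteEdges-distinct c ws j (λ h → bothOpen-true (good h))) (site? _ _ _ _) (reach? _ _ _)
    total : ∀ y → ∑ (tuples 6 four) (λ c → ∑ (tuples 3 (tuples r four)) (count y c)) ≡
                  ∑ (allOpenSets N) (λ U → 1 * ind (site? siteGraph (0F , false) y U))
    total y = sym (trans (∑-cong (allOpenSets N) (λ U → *-identityˡ _))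
                  (trans (∑-unzip N {λ U → ind (site? siteGraph (0F , false) y U)})
                  (trans (∑-tuples-+ 6)
                         (∑-cong (tuples 6 four) (λ c → ∑-tuples-* {n = r} 3)))))

hubsOnly : (p : ℕ) → Vec Bool (p + 3)
hubsOnly p = replicate p false Vec.++ replicate 3 true

E2-less : E2-PrLess (siteGraph 1) (hubsOnly 6) 0F 5F
E2-less =
  prLess (fitting? T) (site? (siteGraph 1) (0F , false) (5F , false)) (site? (siteGraph 1) (0F , false) (5F , true))
    (subst₂ _<_ (sym (total false)) (sym (total true))
      (<-tally (tally-sound 10 (siteRules siteEdges) (siteAt 0F false) (siteAt 5F false) (siteAt 5F true)
                            (tuples 6 oneOf) site-oneOf-counts) (n<1+n 12)))
  where
  open Sites siteEdges 1
  T = hubsOnly 6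
  hubs : Vec Letter 3
  hubs = replicate 3 (true , true)
  f : Bool → OpenSet 9 → ℕ
  f i U = ind (site? (siteGraph 1) (0F , false) (5F , i) U)
  one : ∀ i c → f i (unzip (c Vec.++ hubs)) ≡ ind (reach? (siteRules siteEdges c) (siteAt 0F false) (siteAt 5F i))
  one i c =
    -- For `r = 1` each group is a single letter, and concatenating the three groups gives back
    -- `hubs` by computation.
    ind-⇔ (site-reach siteEdges-distinct c (Vec.map (_∷ []) hubs) (λ _ → 0F) (λ { 0F → refl ; 1F → refl ; 2F → refl }))
           (site? _ _ _ _) (reach? _ _ _)
  total : ∀ i → ∑ (allOpenSets 9) (λ U → ind (fitting? T U) * f i U) ≡
                ∑ (tuples 6 oneOf) (λ c → ind (reach? (siteRules siteEdges c) (siteAt 0F false) (siteAt 5F i)))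
  total i = begin
    ∑ (allOpenSets 9) (λ U → ind (fitting? T U) * f i U)
      ≡⟨ ∑-unzip 9 ⟩
    ∑ (tuples 9 four) (λ w → ind (fitting? T (unzip w)) * f i (unzip w))
      ≡⟨ ∑-cong (tuples 9 four) (λ w → cong (_* f i (unzip w)) (ind-bit (fitting? T (unzip w)) (fitting-⇔ T w))) ⟩
    ∑ (tuples 9 four) (λ w → bit (accepts (fitting T) w) * f i (unzip w))
      ≡⟨ ∑-restrict (fitting T) (replicate 9 four) ⟩
    ∑ (words (zipWith filterᵇ (fitting T) (replicate 9 four))) (f i ∘ unzip)
      -- Filtering `four` leaves `oneOf` at the six path vertices and `both` at the three hubs.
      ≡⟨⟩
    ∑ (words (replicate 6 oneOf Vec.++ replicate 3 both)) (f i ∘ unzip)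
      ≡⟨ ∑-words-++ (replicate 6 oneOf) (replicate 3 both) ⟩
    ∑ (tuples 6 oneOf) (λ c → ∑ [ hubs ] (λ w → f i (unzip (c Vec.++ w))))
      ≡⟨ ∑-cong (tuples 6 oneOf) (λ c → trans (∑-singleton hubs) (one i c)) ⟩
    ∑ (tuples 6 oneOf) (λ c → ind (reach? (siteRules siteEdges c) (siteAt 0F false) (siteAt 5F i)))
      ∎
    where open ≡-Reasoning

-- Nets

-- A net: edge e leads, on its own level, from every place of the first list to
-- every place of the second.
Net : ℕ → ℕ → ℕ → Set
Net p q m = Fin m → Rule (Place p q)

netRule : Net p q m → Vec Letter m → Fin m → Bool → List (Rule (Node p q))
netRule es c e l = guard (layer l (lookup c e)) (map (lift l) (proj₁ (es e)) , map (lift l) (proj₂ (es e)))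

netRules : Net p q m → Vec Letter m → Vec Bool p → List (Rule (Node p q))
netRules es c v = concatMap (λ e → concatMap (netRule es c e) bools) (allFin _) ++ vertRules v

net⁺ : (es : Net p q m) (c : Vec Letter m) (v : Vec Bool p) (e : Fin m) (l : Bool) {x y : Place p q} →
       layer l (lookup c e) ≡ true → x ∈ proj₁ (es e) → y ∈ proj₂ (es e) →
       Fires (netRules es c v) (lift l x) (lift l y)
net⁺ es c v e l o x∈ y∈ =
  ++⁺ˡ (concatMap⁺ (λ e → concatMap (netRule es c e) bools) (lose (∈-allFin e)
    (concatMap⁺ (netRule es c e) (lose (∈-bools l) (guard⁺ o (∈-map⁺ (lift l) x∈ , ∈-map⁺ (lift l) y∈))))))

net-vert⁺ : (es : Net p q m) (c : Vec Letter m) (v : Vec Bool p) {x : Fin p} (i j : Bool) → lookup v x ≡ true →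
            Fires (netRules es c v) (inj₁ (x , i)) (inj₁ (x , j))
net-vert⁺ es c v i j o = ++⁺ʳ (concatMap (λ e → concatMap (netRule es c e) bools) (allFin _)) (vert⁺ v i j o)

data NetFires (es : Net p q m) (c : Vec Letter m) (v : Vec Bool p) : Node p q → Node p q → Set where
  edge : ∀ e l {x y} → layer l (lookup c e) ≡ true → x ∈ proj₁ (es e) → y ∈ proj₂ (es e) →
         NetFires es c v (lift l x) (lift l y)
  vert : ∀ x i j → lookup v x ≡ true → NetFires es c v (inj₁ (x , i)) (inj₁ (x , j))

net⁻ : (es : Net p q m) (c : Vec Letter m) (v : Vec Bool p) {a b : Node p q} →
       Fires (netRules es c v) a b → NetFires es c v a b
net⁻ es c v f with ++⁻ (concatMap (λ e → concatMap (netRule es c e) bools) (allFin _)) f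
... | inj₂ g with vert⁻ v g
...   | x , o , i , j , refl , refl = vert x i j o
net⁻ es c v f | inj₁ g with find (concatMap⁻ (λ e → concatMap (netRule es c e) bools) {xs = allFin _} g)
... | e , _ , g′ with find (concatMap⁻ (netRule es c e) {xs = bools} g′)
...   | l , _ , g″ with guard⁻ (layer l (lookup c e)) g″
...     | o , a∈ , b∈ with ∈-map⁻ (lift l) a∈ | ∈-map⁻ (lift l) b∈
...       | x , x∈ , refl | y , y∈ , refl = edge e l o x∈ y∈

-- Reflecting a net at a vertical edge.

swapped : Letter → Letter
swapped (x , y) = y , x

swapIf : Bool → Letter → Letter
swapIf true  s = swapped s
swapIf false s = s

layer-swapIf : ∀ l b s → layer (l xor b) (swapIf b s) ≡ layer l s
layer-swapIf false false s = refl
layer-swapIf true  false s = refl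
layer-swapIf false true  s = refl
layer-swapIf true  true  s = refl

swapIf-involutive : ∀ b s → swapIf b (swapIf b s) ≡ s
swapIf-involutive false s = refl
swapIf-involutive true  s = refl

swaps : (Fin m → Bool) → Vec Letter m → Vec Letter m
swaps side = zipWith (λ σ s → σ s) (tabulate (swapIf ∘ side))

lookup-swaps : (side : Fin m → Bool) (c : Vec Letter m) (e : Fin m) →
               lookup (swaps side c) e ≡ swapIf (side e) (lookup c e)
lookup-swaps side c e =
  trans (Vecₚ.lookup-zipWith (λ σ s → σ s) e (tabulate (swapIf ∘ side)) c)
        (cong (λ σ → σ (lookup c e)) (Vecₚ.lookup∘tabulate (swapIf ∘ side) e))

swaps-involutive : (side : Fin m → Bool) (c : Vec Letter m) → swaps side (swaps side c) ≡ c
swaps-involutive side []      = refl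
swaps-involutive side (s ∷ c) = cong₂ _∷_ (swapIf-involutive (side zero) s) (swaps-involutive (side ∘ suc) c)

-- One site above `k` decides: for a linear net all sites of the edge other than `k` are then above
-- `k` as well.
side : Net p q m → Fin p → Fin m → Bool
side es k e = does (any? above? (proj₁ (es e) ++ proj₂ (es e)))
  where
  above? : ∀ x → Dec (∃ λ y → x ≡ inj₁ y × k Fin.< y)
  above? (inj₁ x) = map′ (λ lt → x , refl , lt) (λ { (_ , refl , lt) → lt }) (k Finₚ.<? x)
  above? (inj₂ h) = no λ ()

-- b tells whether the edge containing the place lies above k.
Aligned : Bool → Fin p → Place p q → Set
Aligned b k (inj₁ x) = x ≡ k ⊎ does (k Finₚ.<? x) ≡ b
Aligned b k (inj₂ h) = ⊤

aligned? : ∀ b (k : Fin p) (x : Place p q) → Dec (Aligned b k x)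
aligned? b k (inj₁ x) = (x Finₚ.≟ k) ⊎-dec (does (k Finₚ.<? x) Boolₚ.≟ b)
aligned? b k (inj₂ h) = yes tt

-- Every site `k` separates the edges into those below and those above, which share only `k` and
-- hubs. The property is decidable and is checked by evaluation for each example.
Linear : Net p q m → Set
Linear es = ∀ k e → All (Aligned (side es k e) k) (proj₁ (es e)) × All (Aligned (side es k e) k) (proj₂ (es e))

linear? : (es : Net p q m) → Dec (Linear es)
linear? es = Finₚ.all? λ k → Finₚ.all? λ e →
  All.all? (aligned? (side es k e) k) (proj₁ (es e)) ×-dec All.all? (aligned? (side es k e) k) (proj₂ (es e))

-- Reflect everything above k.  An edge lying above k meets k on the wrong level afterwards,
-- which the vertical edge at k repairs.
module Mirror (es : Net p q m) (linear : Linear es) (v : Vec Bool p) (k : Fin p) (vk : lookup v k ≡ true) where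

  flips : Fin p → Bool
  flips x = does (k Finₚ.<? x)

  reflect : Node p q → Node p q
  reflect (inj₁ (x , i)) = inj₁ (x , i xor flips x)
  reflect (inj₂ h)       = inj₂ h

  private
    Reach : Vec Letter m → Node p q → Node p q → Set
    Reach c = Star (Fires (netRules es c v))

  module _ (c : Vec Letter m) where

    private
      c′ : Vec Letter m
      c′ = swaps (side es k) c

      jump : ∀ i j → Reach c′ (inj₁ (k , i)) (inj₁ (k , j))
      jump i j = net-vert⁺ es c′ v i j vk ◅ ε

      descend : ∀ b l x → Aligned b k x → Reach c′ (reflect (lift l x)) (lift (l xor b) x)
      descend b l (inj₁ x) (inj₁ refl) = jump _ _
      descend b l (inj₁ x) (inj₂ refl) = ε
      descend b l (inj₂ h) _           = ε

      ascend : ∀ b l x → Aligned b k x → Reach c′ (lift (l xor b) x) (reflect (lift l x))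
      ascend b l (inj₁ x) (inj₁ refl) = jump _ _
      ascend b l (inj₁ x) (inj₂ refl) = ε
      ascend b l (inj₂ h) _           = ε

      step : ∀ {a b} → NetFires es c v a b → Reach c′ (reflect a) (reflect b)
      step (edge e l {x} {y} o x∈ y∈) =
        descend (side es k e) l x (All.lookup (proj₁ (linear k e)) x∈) ◅◅
        net⁺ es c′ v e (l xor side es k e)
             (trans (trans (cong (layer (l xor side es k e)) (lookup-swaps (side es k) c e))
                           (layer-swapIf l (side es k e) (lookup c e))) o)
             x∈ y∈ ◅
        ascend (side es k e) l y (All.lookup (proj₂ (linear k e)) y∈)
      step (vert x i j o) = net-vert⁺ es c′ v _ _ o ◅ ε

    -- The start is not moved by the reflection. The target changes level in either case: it is
    -- reflected, or it is `k` itself, whose copies are joined.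
    mirror : ∀ {x y i j} → flips x ≡ false → y ≡ k ⊎ flips y ≡ true →
             Reach c (inj₁ (x , i)) (inj₁ (y , j)) → Reach c′ (inj₁ (x , i)) (inj₁ (y , not j))
    mirror {x} {y} {i} {j} fx fy s =
      subst (λ i′ → Reach c′ (inj₁ (x , i′)) (inj₁ (y , j xor flips y))) (trans (cong (i xor_) fx) (Boolₚ.xor-identityʳ i))
            (kleisliStar reflect (step ∘ net⁻ es c v) s)
      ◅◅ end fy
      where
      end : y ≡ k ⊎ flips y ≡ true → Reach c′ (inj₁ (y , j xor flips y)) (inj₁ (y , not j))
      end (inj₁ refl) = jump _ _
      end (inj₂ e) rewrite e = subst (λ b → Reach c′ (inj₁ (y , j xor true)) (inj₁ (y , b))) (xor-true j) ε
        where
        xor-true : ∀ j → j xor true ≡ not j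
        xor-true false = refl
        xor-true true  = refl

  -- Reflection is an involution on samples, so `mirror` applied to the reflected sample gives the
  -- converse.
  mirror-⇔ : ∀ c {x y i j} → flips x ≡ false → y ≡ k ⊎ flips y ≡ true →
             Reach c (inj₁ (x , i)) (inj₁ (y , j)) ⇔ Reach (swaps (side es k) c) (inj₁ (x , i)) (inj₁ (y , not j))
  mirror-⇔ c {x} {y} {i} {j} fx fy = mk⇔ (mirror c fx fy)
    (λ s → subst₂ (λ c j → Reach c (inj₁ (x , i)) (inj₁ (y , j)))
                  (swaps-involutive (side es k) c) (Boolₚ.not-involutive j)
                  (mirror (swaps (side es k) c) fx fy s))

someTrue : (v : Vec Bool n) → (∃ λ k → lookup v k ≡ true) ⊎ v ≡ replicate n false
someTrue []          = inj₂ refl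
someTrue (true ∷ v)  = inj₁ (zero , refl)
someTrue (false ∷ v) = Sum.map (Product.map suc id) (cong (false ∷_)) (someTrue v)

∈-tuples : {l : List A} → (∀ x → x ∈ l) → (w : Vec A n) → w ∈ tuples n l
∈-tuples         all∈ []      = here refl
∈-tuples {n = suc n} {l} all∈ (x ∷ w) =
  concatMap⁺ (λ a → map (a ∷_) (tuples n l)) (lose (all∈ x) (∈-map⁺ (x ∷_) (∈-tuples all∈ w)))

Symmetric : List Letter → Set
Symmetric l = (f : Letter → ℕ) → ∑ l (f ∘ swapped) ≡ ∑ l f

opaque
  unfolding ∑

  four-symmetric : Symmetric four
  four-symmetric f = cong (f (false , false) +_)
    (trans (sym (+-assoc (f (true , false)) (f (false , true)) _))
    (trans (cong (_+ (f (true , true) + 0)) (+-comm (f (true , false)) (f (false , true))))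
           (+-assoc (f (false , true)) (f (true , false)) _)))

  both-symmetric : Symmetric both
  both-symmetric f = refl

net? : (es : Net p q m) (x y : Node p q) (c : Vec Letter m) (v : Vec Bool p) → Dec (Star (Fires (netRules es c v)) x y)
net? es x y c v = reach? (netRules es c v) x y

-- For a pattern `v` with a vertical edge at some `k`, reflection at `k` permutes the samples `c`
-- and exchanges the two events, so they tie. The pattern without vertical edges alone supplies the
-- strict inequality.
net-less : (es : Net (suc p) q m) → Linear es → (ls : Vec (List Letter) m) → (∀ e → Symmetric (lookup ls e)) →
           let u = inj₁ (zero , false); y = Fin.fromℕ p; sites = tuples (suc p) two; none = replicate (suc p) false in
           ∑ (words ls) (λ c → ind (net? es u (inj₁ (y , false)) c none)) <
           ∑ (words ls) (λ c → ind (net? es u (inj₁ (y , true)) c none)) →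
           ∑ (words ls) (λ c → ∑ sites (λ v → ind (net? es u (inj₁ (y , false)) c v))) <
           ∑ (words ls) (λ c → ∑ sites (λ v → ind (net? es u (inj₁ (y , true)) c v)))
net-less {p} {q} {m} es linear ls symmetric lt =
  -- The sum over `v` is moved outside, so that `k` may depend on `v` but not on `c`.
  subst₂ _<_ (∑-comm (tuples (suc p) two) (words ls)) (∑-comm (tuples (suc p) two) (words ls))
    (∑-mono-< below (∈-tuples ∈-bools (replicate (suc p) false)) lt)
  where
  u : Node (suc p) q
  u = inj₁ (zero , false)
  end : Bool → Node (suc p) q
  end i = inj₁ (Fin.fromℕ p , i)
  -- The target is the greatest site, hence never below the mirror.
  last : (k : Fin (suc p)) → Fin.fromℕ p ≡ k ⊎ does (k Finₚ.<? Fin.fromℕ p) ≡ true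
  last k with Finₚ.<-cmp k (Fin.fromℕ p)
  ... | tri< lt _ _ = inj₂ (dec-true (k Finₚ.<? Fin.fromℕ p) lt)
  ... | tri≈ _ eq _ = inj₁ (sym eq)
  ... | tri> _ _ gt = contradiction (Finₚ.≤fromℕ k) (<⇒≱ gt)
  inv : ∀ k e (f : Letter → ℕ) → ∑ (lookup ls e) (λ s → f (lookup (tabulate (swapIf ∘ side es k)) e s)) ≡ ∑ (lookup ls e) f
  inv k e f rewrite Vecₚ.lookup∘tabulate (swapIf ∘ side es k) e with side es k e
  ... | true  = symmetric e f
  ... | false = refl
  below : ∀ v → ∑ (words ls) (λ c → ind (net? es u (end false) c v)) ≤ ∑ (words ls) (λ c → ind (net? es u (end true) c v))
  below v with someTrue v
  ... | inj₂ refl = <⇒≤ lt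
  ... | inj₁ (k , vk) = ≤-reflexive (trans
    (∑-cong (words ls) (λ c → ind-⇔ (Mirror.mirror-⇔ es linear v k vk c (dec-false (k Finₚ.<? zero {n = p}) (λ ())) (last k))
                                     (net? es u (end false) c v) (net? es u (end true) (swaps (side es k) c) v)))
    (∑-permute (tabulate (swapIf ∘ side es k)) ls (inv k) (λ c → ind (net? es u (end true) c v))))

-- Common to hypergraphs and digraphs: a hub node is placed at the lower copy of its representative,
-- and moves on the upper level are padded by walks between the two copies.
net-real : {N : ℕ} (es : Net p q m) (c : Vec Letter m) (v : Vec Bool p) {R : TV N → TV N → Set} (s : Place p q → Fin N) →
           (∀ h i j → Star R (s (inj₂ h) , i) (s (inj₂ h) , j)) →
           (∀ x i → lookup v x ≡ true → R (s (inj₁ x) , i) (s (inj₁ x) , not i)) →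
           (∀ e l {x y} → layer l (lookup c e) ≡ true → x ∈ proj₁ (es e) → y ∈ proj₂ (es e) → Star R (s x , l) (s y , l)) →
           ∃ λ (real : Node p q → TV N) → (∀ x i → real (inj₁ (x , i)) ≡ (s (inj₁ x) , i)) ×
             (∀ {a b} → Fires (netRules es c v) a b → Star R (real a) (real b))
net-real {p} {q} {m} {N} es c v {R} s hub site arc = real , (λ x i → refl) , step ∘ net⁻ es c v
  where
  real : Node p q → TV N
  real (inj₁ (x , i)) = s (inj₁ x) , i
  real (inj₂ h)       = s (inj₂ h) , false
  descend : ∀ l x → Star R (real (lift l x)) (s x , l)
  descend l (inj₁ x) = ε
  descend l (inj₂ h) = hub h false l
  ascend : ∀ l x → Star R (s x , l) (real (lift l x))
  ascend l (inj₁ x) = ε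
  ascend l (inj₂ h) = hub h l false
  step : ∀ {a b} → NetFires es c v a b → Star R (real a) (real b)
  step (edge e l {x} {y} o x∈ y∈) = descend l x ◅◅ arc e l o x∈ y∈ ◅◅ ascend l y
  step (vert x false false o) = ε
  step (vert x false true  o) = site x false o ◅ ε
  step (vert x true  false o) = site x true o ◅ ε
  step (vert x true  true  o) = ε

vert-lift : (es : Net p q m) (c : Vec Letter m) (v : Vec Bool p) (ws : Vec (Vec Bool r) q) (a : Fin (p + q * r)) (i : Bool) →
            lookup (v Vec.++ Vec.concat ws) a ≡ true →
            Star (Fires (netRules es c v)) (lift i (place {p} {q} {r} a)) (lift (not i) (place {p} {q} {r} a))
vert-lift {p} {q} {r = r} es c v ws a i o with place {p} {q} {r} a in eq
... | inj₂ h = ε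
... | inj₁ x rewrite place-inj₁ {p} {q} {r} a eq =
  net-vert⁺ es c v i (not i) (trans (sym (Vecₚ.lookup-++ˡ v (Vec.concat ws) x)) o) ◅ ε

-- Hypergraphs

equals : Vec Bool n → Vec (Bool → Bool) n
equals = Vec.map (λ t b → does (b Boolₚ.≟ t))

equals-⇔ : (T v : Vec Bool n) → v ≡ T ⇔ accepts (equals T) v ≡ true
equals-⇔ T v = mk⇔ (to T v) (from T v)
  where
  to : ∀ {n} (T v : Vec Bool n) → v ≡ T → accepts (equals T) v ≡ true
  to []      []      e    = refl
  to (t ∷ T) (t ∷ T) refl = cong₂ _∧_ (dec-true (t Boolₚ.≟ t) refl) (to T T refl)
  from : ∀ {n} (T v : Vec Bool n) → accepts (equals T) v ≡ true → v ≡ T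
  from []      []      e = refl
  from (t ∷ T) (b ∷ v) e with ∧-true {does (b Boolₚ.≟ t)} e
  ... | e₁ , e₂ = cong₂ _∷_ (does-true (b Boolₚ.≟ t) e₁) (from T v e₂)

words-equals : (T : Vec Bool n) → words (zipWith filterᵇ (equals T) (replicate n two)) ≡ [ T ]
words-equals []          = refl
words-equals (true ∷ T)  rewrite words-equals T = refl
words-equals (false ∷ T) rewrite words-equals T = refl

-- The vertical part is forced to be `T`, and the horizontal part is again a product of filtered
-- letter lists. All entries of `F` false gives the model E₄, general `F` the model E₆.
∑-admissible : (F : Vec Bool m) (T : Vec Bool n) {V : EdgeSel m n → Set} (V? : ∀ X → Dec (V X)) →
               (∀ X → V X ⇔ (E2-Valid F (proj₁ X) × verts X ≡ T)) → (f : EdgeSel m n → ℕ) →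
               ∑ (allEdgeSels m n) (λ X → ind (V? X) * f X) ≡
               ∑ (words (zipWith filterᵇ (fitting F) (replicate m four))) (λ w → f (unzip w , T))
∑-admissible {m} {n} F T V? V⇔ f = begin
  ∑ (allEdgeSels m n) (λ X → ind (V? X) * f X)
    ≡⟨ ∑-edgeSels m n ⟩
  ∑ (tuples m four) (λ w → ∑ (tuples n two) (λ v → ind (V? (unzip w , v)) * f (unzip w , v)))
    ≡⟨ ∑-cong (tuples m four) (λ w →
         trans (∑-cong (tuples n two) (split w)) (∑-* (bit (accepts (fitting F) w)) (tuples n two))) ⟩
  ∑ (tuples m four) (λ w → bit (accepts (fitting F) w) * ∑ (tuples n two) (λ v → bit (accepts (equals T) v) * f (unzip w , v)))
    ≡⟨ ∑-restrict (fitting F) (replicate m four) ⟩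
  ∑ (words (zipWith filterᵇ (fitting F) (replicate m four)))
    (λ w → ∑ (tuples n two) (λ v → bit (accepts (equals T) v) * f (unzip w , v)))
    ≡⟨ ∑-cong (words (zipWith filterᵇ (fitting F) (replicate m four))) (λ w → trans (∑-restrict (equals T) (replicate n two))
         (trans (cong (λ l → ∑ l (λ v → f (unzip w , v))) (words-equals T)) (∑-singleton T))) ⟩
  ∑ (words (zipWith filterᵇ (fitting F) (replicate m four))) (λ w → f (unzip w , T))
    ∎
  where
  open ≡-Reasoning
  split : ∀ w v → ind (V? (unzip w , v)) * f (unzip w , v) ≡
                  bit (accepts (fitting F) w) * (bit (accepts (equals T) v) * f (unzip w , v))
  split w v = trans (cong (_* f (unzip w , v))
    (trans (ind-⇔ (V⇔ (unzip w , v)) (V? (unzip w , v)) (fitting? F (unzip w) ×-dec Vecₚ.≡-dec Boolₚ._≟_ v T))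
    (trans (ind-× (fitting? F (unzip w)) (Vecₚ.≡-dec Boolₚ._≟_ v T))
           (cong₂ _*_ (ind-bit (fitting? F (unzip w)) (fitting-⇔ F w))
                      (ind-bit (Vecₚ.≡-dec Boolₚ._≟_ v T) (equals-⇔ T v))))))
    (*-assoc (bit (accepts (fitting F) w)) _ _)

module Hypers (L : Fin m → List (Place p q)) (r : ℕ) where

  private
    N : ℕ
    N = p + q * r

    at : Fin N → Place p q
    at = place {p} {q} {r}

    in? : ∀ e x → Dec (x ∈ L e)
    in? e x = any? (x ≟ᵖ_) (L e)

    edges : Fin m → Vec Bool N
    edges e = tabulate (λ a → does (in? e (at a)))

    edges⁺ : ∀ e a → at a ∈ L e → lookup (edges e) a ≡ true
    edges⁺ e a x∈ = trans (Vecₚ.lookup∘tabulate _ a) (dec-true (in? e (at a)) x∈)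

    edges⁻ : ∀ e a → lookup (edges e) a ≡ true → at a ∈ L e
    edges⁻ e a o = does-true (in? e (at a)) (trans (sym (Vecₚ.lookup∘tabulate _ a)) o)

  -- Both conditions look at sites only, which have one copy each, so they are finite checks that do
  -- not depend on `r`.
  Occupied Separated : Set
  Occupied  = ∀ e → ∃ λ x → inj₁ x ∈ L e
  Separated = ∀ e f → (∀ x → does (any? (inj₁ x ≟ᵖ_) (L e)) ≡ does (any? (inj₁ x ≟ᵖ_) (L f))) → e ≡ f

  hypergraph : Occupied → Separated → Hypergraph N m
  hypergraph occupied separated = record
    { edge     = edges
    ; nonempty = λ e → proj₁ (occupied e) ↑ˡ (q * r) ,
                       edges⁺ e _ (subst (_∈ L e) (sym (site-at (proj₁ (occupied e)))) (proj₂ (occupied e)))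
    ; distinct = λ e f eq → separated e f (λ x →
                   trans (sym (site-bit e x)) (trans (cong (λ v → lookup v (x ↑ˡ (q * r))) eq) (site-bit f x)))
    }
    where
    site-at : ∀ x → at (x ↑ˡ (q * r)) ≡ inj₁ x
    site-at x = cong (Sum.map₂ (quotient {q} r)) (Finₚ.splitAt-↑ˡ p x (q * r))
    site-bit : ∀ e x → lookup (edges e) (x ↑ˡ (q * r)) ≡ does (in? e (inj₁ x))
    site-bit e x = trans (Vecₚ.lookup∘tabulate _ (x ↑ˡ (q * r))) (cong (λ y → does (in? e y)) (site-at x))

  net : Net p q m
  net e = L e , L e

  module _ (occupied : Occupied) (separated : Separated)
           (c : Vec Letter m) (v : Vec Bool p) (ws : Vec (Vec Bool r) q)
           (j : Fin q → Fin r) (good : ∀ h → lookup (lookup ws h) (j h) ≡ true) where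

    private
      X : EdgeSel m N
      X = unzip c , v Vec.++ Vec.concat ws

      Step : TV N → TV N → Set
      Step = HStep (hypergraph occupied separated) X

      forward : ∀ {a b} → Step a b → Star (Fires (netRules net c v)) (lift (proj₂ a) (at (proj₁ a)))
                                                                      (lift (proj₂ b) (at (proj₁ b)))
      forward (horiz {a} {b} {i} e o a∈ b∈) =
        net⁺ net c v e i (trans (sym (lookup-unzip c i e)) o) (edges⁻ e a a∈) (edges⁻ e b b∈) ◅ ε
      forward (vert {a} {i} o) = vert-lift net c v ws a i o

      hub : ∀ h i i′ → Star Step (spot {q} {r} {p} j (inj₂ h) , i) (spot j (inj₂ h) , i′)
      hub h false false = ε
      hub h true  true  = ε
      hub h false true  = vert (trans (lookup-group v ws h (j h)) (good h)) ◅ ε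
      hub h true  false = vert (trans (lookup-group v ws h (j h)) (good h)) ◅ ε

      real : ∃ λ (real : Node p q → TV N) → (∀ x i → real (inj₁ (x , i)) ≡ (spot j (inj₁ x) , i)) ×
               (∀ {a b} → Fires (netRules net c v) a b → Star Step (real a) (real b))
      real = net-real net c v (spot j) hub
        (λ x i o → vert (trans (Vecₚ.lookup-++ˡ v (Vec.concat ws) x) o))
        (λ e l {x} {y} o x∈ y∈ → horiz e (trans (lookup-unzip c l e) o)
          (edges⁺ e _ (subst (_∈ L e) (sym (place-spot {q} {r} j x)) x∈))
          (edges⁺ e _ (subst (_∈ L e) (sym (place-spot {q} {r} j y)) y∈)) ◅ ε)

    hyper-reach : ∀ {x y i i′} → Star Step (x ↑ˡ (q * r) , i) (y ↑ˡ (q * r) , i′) ⇔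
                                 Star (Fires (netRules net c v)) (inj₁ (x , i)) (inj₁ (y , i′))
    hyper-reach {x} {y} {i} {i′} =
      star-⇔ (λ a → lift (proj₂ a) (at (proj₁ a))) (proj₁ real) forward (proj₂ (proj₂ real))
             (cong (lift i) (place-spot {q} {r} j (inj₁ x))) (cong (lift i′) (place-spot {q} {r} j (inj₁ y)))
             (proj₁ (proj₂ real) x i) (proj₁ (proj₂ real) y i′)

hyperStep? : {N M : ℕ} (H : Hypergraph N M) (X : EdgeSel M N) → Decidable (HStep H X)
hyperStep? H X (a , i) (b , j) = map′ to from
  ((i Boolₚ.≟ j ×-dec Finₚ.any? (λ e → lookup (hor X i) e Boolₚ.≟ true ×-dec
      lookup (Hypergraph.edge H e) a Boolₚ.≟ true ×-dec lookup (Hypergraph.edge H e) b Boolₚ.≟ true))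
   ⊎-dec (a Finₚ.≟ b ×-dec j Boolₚ.≟ not i ×-dec lookup (verts X) a Boolₚ.≟ true))
  where
  to : _ → HStep H X (a , i) (b , j)
  to (inj₁ (refl , e , o , a∈ , b∈)) = horiz e o a∈ b∈
  to (inj₂ (refl , refl , o)) = vert o
  from : HStep H X (a , i) (b , j) → _
  from (horiz e o a∈ b∈) = inj₁ (refl , e , o , a∈ , b∈)
  from (vert o) = inj₂ (refl , refl , o)

hyper? : {N M : ℕ} (H : Hypergraph N M) (x y : TV N) (X : EdgeSel M N) → Dec (Star (HStep H X) x y)
hyper? H x y X = star? (tvs _) ∈-tvs _≟ᵛ_ (hyperStep? H X) x y

-- The path hypergraph: models E₄ and E₅.

pathEdges : Fin 6 → List (Place 7 3)
pathEdges e = inj₁ (inject₁ e) ∷ inj₁ (suc e) ∷ inj₂ (hubOf e) ∷ []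

pathNet : Net 7 3 6
pathNet e = pathEdges e , pathEdges e

pathRules : Vec Letter 6 → List (Rule (Node 7 3))
pathRules c = netRules pathNet c (replicate 7 false)

opaque
  path-counts : tally 10 pathRules (siteAt 0F false) (siteAt 6F false) (siteAt 6F true)
                      (tuples 6 four) ≡ just (703 , 704)
  path-counts = refl

  path-oneOf-counts : tally 10 pathRules (siteAt 0F false) (siteAt 6F false) (siteAt 6F true)
                            (tuples 6 oneOf) ≡ just (12 , 13)
  path-oneOf-counts = refl

opaque
  path-linear : Linear pathNet
  path-linear = from-yes (linear? pathNet)

path-less : ∑ (tuples 6 four) (λ c → ∑ (tuples 7 two) (λ v → ind (net? pathNet (siteAt 0F false) (siteAt 6F false) c v))) <
            ∑ (tuples 6 four) (λ c → ∑ (tuples 7 two) (λ v → ind (net? pathNet (siteAt 0F false) (siteAt 6F true) c v)))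
path-less = net-less pathNet path-linear (replicate 6 four)
  (λ e → subst Symmetric (sym (Vecₚ.lookup-replicate e four)) four-symmetric)
  (<-tally (tally-sound 10 pathRules (siteAt 0F false) (siteAt 6F false) (siteAt 6F true)
                        (tuples 6 four) path-counts) (n<1+n 703))

opaque
  unfolding ∑

  size-two : size two ≡ 2
  size-two = refl

  misses-two : ∑ two (bit ∘ not ∘ id) ≡ 1
  misses-two = refl

module _ (r : ℕ) where
  open Hypers pathEdges r

  opaque
    path-separated : Separated
    path-separated = from-yes (Finₚ.all? λ e → Finₚ.all? λ f →
      Finₚ.all? (λ x → does (any? (inj₁ x ≟ᵖ_) (pathEdges e)) Boolₚ.≟ does (any? (inj₁ x ≟ᵖ_) (pathEdges f))) →-dec (e Finₚ.≟ f))

  pathHypergraph : Hypergraph (7 + 3 * r) 6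
  pathHypergraph = hypergraph (λ e → inject₁ e , here refl) path-separated

  pathCount : Bool → EdgeSel 6 (7 + 3 * r) → ℕ
  pathCount i X = ind (hyper? pathHypergraph (0F , false) (6F , i) X)

  -- Serves E₅ for the good choices at the hubs and, with `r = 1`, E₄, where the forced vertical
  -- edges make the only choice good.
  pathCount-good : ∀ i c v ws → every (some id) ws ≡ true →
               pathCount i (unzip c , v Vec.++ Vec.concat ws) ≡ ind (net? pathNet (siteAt 0F false) (siteAt 6F i) c v)
  pathCount-good i c v ws e with pick id ws e
  ... | j , good = ind-⇔ (hyper-reach (λ e → inject₁ e , here refl) path-separated c v ws j good)
                         (hyper? _ _ _ _) (net? pathNet _ _ c v)

  -- The core now includes the seven random vertical edges at the xᵢ, whence the factor 2⁷. A hub is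
  -- bad if none of its `r` copies has its vertical edge.
  E5-less : 4 ^ 6 * 2 ^ 7 * (2 ^ r) ^ 3 < suc (4 ^ 6 * 2 ^ 7) * (2 ^ r ∸ 1 ^ r) ^ 3 → E5-PrLess pathHypergraph 0F 6F
  E5-less few =
    prLess (λ _ → yes tt) (hyper? pathHypergraph (0F , false) (6F , false)) (hyper? pathHypergraph (0F , false) (6F , true))
      (subst₂ _<_ (total false) (total true)
        (thicken {P = P false} {Q = P true} (every (some id))
          (λ (c , v) ws → ind≤1 (hyper? pathHypergraph (0F , false) (6F , false) (unzip c , v Vec.++ Vec.concat ws)))
          (λ (c , v) ws e → pathCount-good false c v ws e , pathCount-good true c v ws e)
          (subst₂ _<_ (sym (∑-× (tuples 6 four) (tuples 7 two))) (sym (∑-× (tuples 6 four) (tuples 7 two))) path-less)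
          (subst₂ _<_ (cong₂ _*_ (sym sizeC) (sym sizeW)) (cong₂ (λ x y → suc x * y) (sym sizeC) (sym goodW)) few)))
    where
    Cs : List (Vec Letter 6 × Vec Bool 7)
    Cs = cartesianProduct (tuples 6 four) (tuples 7 two)
    Ws : List (Vec (Vec Bool r) 3)
    Ws = tuples 3 (tuples r two)
    P : Bool → Vec Letter 6 × Vec Bool 7 → Vec (Vec Bool r) 3 → ℕ
    P i (c , v) ws = pathCount i (unzip c , v Vec.++ Vec.concat ws)
    sizeC : size Cs ≡ 4 ^ 6 * 2 ^ 7
    sizeC = trans (size-× (tuples 6 four) (tuples 7 two))
                  (cong₂ _*_ (trans (size-tuples 6 four) (cong (_^ 6) size-four))
                             (trans (size-tuples 7 two) (cong (_^ 7) size-two)))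
    sizeW : size Ws ≡ (2 ^ r) ^ 3
    sizeW = trans (size-groups 3 r two) (cong (λ s → (s ^ r) ^ 3) size-two)
    goodW : ∑ Ws (bit ∘ every (some id)) ≡ (2 ^ r ∸ 1 ^ r) ^ 3
    goodW = trans (∑-groups id 3 r two) (cong₂ (λ s t → (s ^ r ∸ t ^ r) ^ 3) size-two misses-two)
    total : ∀ i → ∑ Cs (λ x → ∑ Ws (P i x)) ≡ ∑ (allEdgeSels 6 (7 + 3 * r)) (λ X → 1 * pathCount i X)
    total i = sym (trans (∑-cong (allEdgeSels 6 (7 + 3 * r)) (λ X → *-identityˡ (pathCount i X)))
                  (trans (∑-edgeSels 6 (7 + 3 * r))
                  (trans (∑-cong (tuples 6 four) (λ c →
                           trans (∑-tuples-+ 7) (∑-cong (tuples 7 two) (λ v → ∑-tuples-* {n = r} 3))))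
                         (sym (∑-× (tuples 6 four) (tuples 7 two))))))

E4-less : E4-PrLess (pathHypergraph 1) (hubsOnly 7) 0F 6F
E4-less =
  prLess valid? (hyper? (pathHypergraph 1) (0F , false) (6F , false)) (hyper? (pathHypergraph 1) (0F , false) (6F , true))
    (subst₂ _<_ (sym (total false)) (sym (total true))
      (<-tally (tally-sound 10 pathRules (siteAt 0F false) (siteAt 6F false) (siteAt 6F true)
                            (tuples 6 oneOf) path-oneOf-counts) (n<1+n 12)))
  where
  T : Vec Bool 10
  T = hubsOnly 7
  valid? : ∀ X → Dec (E4-Valid T X)
  valid? X = Finₚ.all? (λ e → lookup (hor X false) e Boolₚ.≟ not (lookup (hor X true) e)) ×-dec Vecₚ.≡-dec Boolₚ._≟_ (verts X) T
  valid-⇔ : ∀ X → E4-Valid T X ⇔ (E2-Valid (replicate 6 false) (proj₁ X) × verts X ≡ T)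
  valid-⇔ X = mk⇔
    (λ (o , e) → (λ a → (λ t → contradiction (trans (sym t) (Vecₚ.lookup-replicate a false)) λ ()) , λ _ → o a) , e)
    (λ (o , e) → (λ a → proj₂ (o a) (Vecₚ.lookup-replicate a false)) , e)
  total : ∀ i → ∑ (allEdgeSels 6 10) (λ X → ind (valid? X) * ind (hyper? (pathHypergraph 1) (0F , false) (6F , i) X)) ≡
                ∑ (tuples 6 oneOf) (λ c → ind (net? pathNet (siteAt 0F false) (siteAt 6F i) c (replicate 7 false)))
  total i = trans
    (∑-admissible (replicate 6 false) T valid? valid-⇔ (λ X → ind (hyper? (pathHypergraph 1) (0F , false) (6F , i) X)))
    (∑-cong (tuples 6 oneOf) (λ c → pathCount-good 1 i c (replicate 7 false) (replicate 3 (true ∷ [])) refl))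

-- Digraphs

single : Place p q × Place p q → Rule (Place p q)
single (x , y) = [ x ] , [ y ]

arcNet : (Fin m → Place p q × Place p q) → (Fin n → Place p q × Place p q) → Net p q (m + n)
arcNet {m = m} random fixed e = single ([ random , fixed ]′ (splitAt m e))

-- Copy 0 of a hub carries its arcs; the other r copies are satellites, joined to
-- it in both directions.  Fixed arcs and satellite arcs are taken k-fold.
module Digraphs {s t : ℕ} (random : Fin s → Place p q × Place p q) (fixed : Fin t → Place p q × Place p q) (r k : ℕ) where

  -- Copies of a hub cannot be used as for hypergraphs: a single hyperedge contains all of them, but
  -- a random arc at a hub would split into several independent arcs. Satellites supply further
  -- vertical edges while each random arc stays single; the `#L` links are the arcs that should
  -- always be present.
  #V #L #A : ℕ
  #V = p + q * suc r
  #L = t + (q * r + q * r)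
  #A = s + #L * k

  private
    at : Fin #V → Place p q
    at = place {p} {q} {suc r}

    base : Place p q → Fin #V
    base = spot (λ _ → zero)

    at-base : ∀ x → at (base x) ≡ x
    at-base = place-spot {q} {suc r} (λ _ → zero)

    hub : Fin q → Fin #V
    hub h = base (inj₂ h)

    satellite : Fin q → Fin r → Fin #V
    satellite h j = p ↑ʳ combine h (suc j)

    ends₂ : Place p q × Place p q → Fin #V × Fin #V
    ends₂ (x , y) = base x , base y

    out back : Fin (q * r) → Fin #V × Fin #V
    out  a = hub (proj₁ (remQuot {q} r a)) , satellite (proj₁ (remQuot {q} r a)) (proj₂ (remQuot {q} r a))
    back a = proj₂ (out a) , proj₁ (out a)

    net : Net p q (s + t)
    net = arcNet random fixed

    link : Fin #L → Fin #V × Fin #V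
    link b = [ ends₂ ∘ fixed , (λ a → [ out , back ]′ (splitAt (q * r) a)) ]′ (splitAt t b)

  arcs : Fin #A → Fin #V × Fin #V
  arcs a = [ ends₂ ∘ random , link ∘ quotient k ]′ (splitAt s a)

  module _ (c : Vec Letter s) (gs : Vec (Vec Letter k) #L) (v : Vec Bool p) (ws : Vec (Vec Bool (suc r)) q)
           (g : Fin #L → Fin k) (good : ∀ b → lookup (lookup gs b) (g b) ≡ (true , true))
           (j : Fin q → Fin (suc r)) (on : ∀ h → lookup (lookup ws h) (j h) ≡ true) where

    private
      X : EdgeSel #A #V
      X = unzip (c Vec.++ Vec.concat gs) , v Vec.++ Vec.concat ws

      c⁺ : Vec Letter (s + t)
      c⁺ = c Vec.++ replicate t (true , true)

      Step : TV #V → TV #V → Set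
      Step = DStep arcs X

      Core : Node p q → Node p q → Set
      Core = Star (Fires (netRules net c⁺ v))

      layer-true : ∀ i → layer i (true , true) ≡ true
      layer-true false = refl
      layer-true true  = refl

      fire-random : ∀ e l → layer l (lookup c e) ≡ true →
                    Core (lift l (proj₁ (random e))) (lift l (proj₂ (random e)))
      fire-random e l o = net⁺ net c⁺ v (e ↑ˡ t) l (trans (cong (layer l) (Vecₚ.lookup-++ˡ c _ e)) o)
        (subst (λ z → proj₁ (random e) ∈ proj₁ (single z)) (sym eq) (here refl))
        (subst (λ z → proj₂ (random e) ∈ proj₂ (single z)) (sym eq) (here refl)) ◅ ε
        where
        eq : [ random , fixed ]′ (splitAt s (e ↑ˡ t)) ≡ random e
        eq = cong [ random , fixed ]′ (Finₚ.splitAt-↑ˡ s e t)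

      fire-fixed : ∀ f l → Core (lift l (proj₁ (fixed f))) (lift l (proj₂ (fixed f)))
      fire-fixed f l = net⁺ net c⁺ v (s ↑ʳ f) l
        (trans (cong (layer l) (trans (Vecₚ.lookup-++ʳ c _ f) (Vecₚ.lookup-replicate f _))) (layer-true l))
        (subst (λ z → proj₁ (fixed f) ∈ proj₁ (single z)) (sym eq) (here refl))
        (subst (λ z → proj₂ (fixed f) ∈ proj₂ (single z)) (sym eq) (here refl)) ◅ ε
        where
        eq : [ random , fixed ]′ (splitAt s (s ↑ʳ f)) ≡ fixed f
        eq = cong [ random , fixed ]′ (Finₚ.splitAt-↑ʳ s t f)

      along : ∀ l {a b x y} → (base x , base y) ≡ (a , b) → Core (lift l x) (lift l y) → Core (lift l (at a)) (lift l (at b))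
      along l {x = x} {y} refl = subst₂ Core (cong (lift l) (sym (at-base x))) (cong (lift l) (sym (at-base y)))

      same-hub : ∀ a → at (proj₁ (out a)) ≡ at (proj₂ (out a))
      same-hub a = trans (place-combine {q} {suc r} {p} (proj₁ (remQuot {q} r a)) zero)
                         (sym (place-combine (proj₁ (remQuot {q} r a)) (suc (proj₂ (remQuot {q} r a)))))

      -- A fixed arc is an arc of the core; a satellite arc joins vertices that collapse to the same
      -- hub and becomes the empty walk.
      link-core : ∀ b l {x y} → link b ≡ (x , y) → Core (lift l (at x)) (lift l (at y))
      link-core b l e with splitAt t b
      ... | inj₁ f = along l e (fire-fixed f l)
      ... | inj₂ a with splitAt (q * r) a
      link-core b l refl | inj₂ a | inj₁ a′ = subst (λ z → Core (lift l (at (proj₁ (out a′)))) (lift l z)) (same-hub a′) ε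
      link-core b l refl | inj₂ a | inj₂ a′ = subst (λ z → Core (lift l z) (lift l (at (proj₁ (out a′))))) (same-hub a′) ε

      forward : ∀ {a b} → Step a b → Core (lift (proj₂ a) (at (proj₁ a))) (lift (proj₂ b) (at (proj₁ b)))
      forward (vert {a} {i} o) = vert-lift net c⁺ v ws a i o
      forward (horiz {i = i} e o eq) with splitAt s e in eqₛ
      ... | inj₂ b  = link-core (quotient k b) i eq
      ... | inj₁ e′ = along i eq (fire-random e′ i
        (trans (cong (layer i) (sym (trans (cong (lookup (c Vec.++ Vec.concat gs)) (sym (Finₚ.splitAt⁻¹-↑ˡ eqₛ)))
                                           (Vecₚ.lookup-++ˡ c _ e′))))
               (trans (sym (lookup-unzip (c Vec.++ Vec.concat gs) i e)) o)))

      follow : ∀ b l → Step (proj₁ (link b) , l) (proj₂ (link b) , l)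
      follow b l = horiz (s ↑ʳ combine b (g b))
        (trans (lookup-unzip (c Vec.++ Vec.concat gs) l (s ↑ʳ combine b (g b)))
               (trans (cong (layer l) (trans (lookup-group c gs b (g b)) (good b))) (layer-true l)))
        (trans (cong [ ends₂ ∘ random , link ∘ quotient k ]′ (Finₚ.splitAt-↑ʳ s (#L * k) (combine b (g b))))
               (cong (link ∘ proj₁) (Finₚ.remQuot-combine b (g b))))

      follow-to : ∀ b l {x y} → link b ≡ (x , y) → Step (x , l) (y , l)
      follow-to b l refl = follow b l

      link-fixed : ∀ f → link (f ↑ˡ (q * r + q * r)) ≡ ends₂ (fixed f)
      link-fixed f = cong [ ends₂ ∘ fixed , _ ]′ (Finₚ.splitAt-↑ˡ t f (q * r + q * r))

      out-combine : ∀ h i → out (combine h i) ≡ (hub h , satellite h i)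
      out-combine h i = cong (λ (h , i) → hub h , satellite h i) (Finₚ.remQuot-combine h i)

      link-out : ∀ h i → link (t ↑ʳ (combine h i ↑ˡ (q * r))) ≡ (hub h , satellite h i)
      link-out h i =
        trans (cong [ ends₂ ∘ fixed , (λ a → [ out , back ]′ (splitAt (q * r) a)) ]′
                    (Finₚ.splitAt-↑ʳ t (q * r + q * r) _))
        (trans (cong [ out , back ]′ (Finₚ.splitAt-↑ˡ (q * r) (combine h i) (q * r))) (out-combine h i))

      link-back : ∀ h i → link (t ↑ʳ (q * r ↑ʳ combine h i)) ≡ (satellite h i , hub h)
      link-back h i =
        trans (cong [ ends₂ ∘ fixed , (λ a → [ out , back ]′ (splitAt (q * r) a)) ]′
                    (Finₚ.splitAt-↑ʳ t (q * r + q * r) _))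
        (trans (cong [ out , back ]′ (Finₚ.splitAt-↑ʳ (q * r) (q * r) (combine h i)))
               (cong (λ (x , y) → y , x) (out-combine h i)))

      flip : ∀ h i → Star Step (hub h , i) (hub h , not i)
      flip h i with j h | trans (lookup-group v ws h (j h)) (on h)
      ... | zero   | o = vert o ◅ ε
      -- Out to the satellite, across its vertical edge, and back to the hub on the other level.
      ... | suc i′ | o = follow-to _ i (link-out h i′) ◅ vert o ◅ follow-to _ (not i) (link-back h i′) ◅ ε

      levels : ∀ h i i′ → Star Step (hub h , i) (hub h , i′)
      levels h false false = ε
      levels h true  true  = ε
      levels h false true  = flip h false
      levels h true  false = flip h true

      cross : ∀ e l {x y} → layer l (lookup c⁺ e) ≡ true → x ∈ proj₁ (net e) → y ∈ proj₂ (net e) →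
              Star Step (base x , l) (base y , l)
      cross e l o x∈ y∈ with splitAt s e in eqₛ
      cross e l o (here refl) (here refl) | inj₂ f = follow-to _ l (link-fixed f) ◅ ε
      cross e l o (here refl) (here refl) | inj₁ e′ = horiz (e′ ↑ˡ (#L * k))
        (trans (lookup-unzip (c Vec.++ Vec.concat gs) l (e′ ↑ˡ (#L * k)))
          (trans (cong (layer l) (trans (Vecₚ.lookup-++ˡ c (Vec.concat gs) e′)
                   (sym (trans (cong (lookup c⁺) (sym (Finₚ.splitAt⁻¹-↑ˡ eqₛ))) (Vecₚ.lookup-++ˡ c _ e′))))) o))
        (cong [ ends₂ ∘ random , link ∘ quotient k ]′ (Finₚ.splitAt-↑ˡ s e′ (#L * k))) ◅ ε

      real : ∃ λ (real : Node p q → TV #V) → (∀ x i → real (inj₁ (x , i)) ≡ (base (inj₁ x) , i)) ×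
               (∀ {a b} → Fires (netRules net c⁺ v) a b → Star Step (real a) (real b))
      real = net-real net c⁺ v base levels (λ x i o → vert (trans (Vecₚ.lookup-++ˡ v (Vec.concat ws) x) o)) cross

    di-reach : ∀ {x y i i′} → Star Step (x ↑ˡ (q * suc r) , i) (y ↑ˡ (q * suc r) , i′) ⇔ Core (inj₁ (x , i)) (inj₁ (y , i′))
    di-reach {x} {y} {i} {i′} =
      star-⇔ (λ a → lift (proj₂ a) (at (proj₁ a))) (proj₁ real) forward (proj₂ (proj₂ real))
             (cong (lift i) (at-base (inj₁ x))) (cong (lift i′) (at-base (inj₁ y)))
             (proj₁ (proj₂ real) x i) (proj₁ (proj₂ real) y i′)

diStep? : {N M : ℕ} (arc : Fin M → Fin N × Fin N) (X : EdgeSel M N) → Decidable (DStep arc X)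
diStep? arc X (a , i) (b , j) = map′ to from
  ((i Boolₚ.≟ j ×-dec Finₚ.any? (λ e → lookup (hor X i) e Boolₚ.≟ true ×-dec ×-≡-dec Finₚ._≟_ Finₚ._≟_ (arc e) (a , b)))
   ⊎-dec (a Finₚ.≟ b ×-dec j Boolₚ.≟ not i ×-dec lookup (verts X) a Boolₚ.≟ true))
  where
  to : _ → DStep arc X (a , i) (b , j)
  to (inj₁ (refl , e , o , eq)) = horiz e o eq
  to (inj₂ (refl , refl , o)) = vert o
  from : DStep arc X (a , i) (b , j) → _
  from (horiz e o eq) = inj₁ (refl , e , o , eq)
  from (vert o) = inj₂ (refl , refl , o)

di? : {N M : ℕ} (arc : Fin M → Fin N × Fin N) (x y : TV N) (X : EdgeSel M N) → Dec (Star (DStep arc X) x y)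
di? arc x y X = star? (tvs _) ∈-tvs _≟ᵛ_ (diStep? arc X) x y

-- The zigzag digraph: models E₆ and E₇.

randomArcs : Fin 4 → Place 6 3 × Place 6 3
randomArcs 0F = inj₁ 1F , inj₂ 1F
randomArcs 1F = inj₂ 0F , inj₁ 2F
randomArcs 2F = inj₁ 3F , inj₂ 2F
randomArcs 3F = inj₂ 1F , inj₁ 4F

-- Let the random arcs be present on one level each, `b`, `a`, `d`, `c` in their order. Hub 1 is
-- missed iff `b` is upper and `a` lower. Hub 2, which leads to site 5 on both levels, is missed iff
-- `d ≠ a` and moreover hub 1 is missed or `d ≠ c`. So site 5 on level `y` is missed in two cases
-- with hub 1 missed (`c` is free), and otherwise iff `a = c ≠ y` and `d = y`, which leaves two
-- values of `b` for lower `y` and one for upper `y`. This is 4 against 3 misses out of 16.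
fixedArcs : Fin 7 → Place 6 3 × Place 6 3
fixedArcs 0F = inj₁ 0F , inj₂ 0F
fixedArcs 1F = inj₁ 0F , inj₁ 1F
fixedArcs 2F = inj₁ 2F , inj₁ 1F
fixedArcs 3F = inj₁ 2F , inj₁ 3F
fixedArcs 4F = inj₁ 4F , inj₁ 3F
fixedArcs 5F = inj₁ 4F , inj₁ 5F
fixedArcs 6F = inj₂ 2F , inj₁ 5F

open Digraphs randomArcs fixedArcs using () renaming (arcs to zigzagArcs)

zigzagNet : Net 6 3 11
zigzagNet = arcNet randomArcs fixedArcs

withFixed : Vec Letter 4 → Vec Letter 11
withFixed c = c Vec.++ replicate 7 (true , true)

zigzagRules : Vec Letter 4 → List (Rule (Node 6 3))
zigzagRules c = netRules zigzagNet (withFixed c) (replicate 6 false)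

opaque
  zigzag-counts : tally 10 zigzagRules (siteAt 0F false) (siteAt 5F false) (siteAt 5F true)
                      (tuples 4 four) ≡ just (160 , 161)
  zigzag-counts = refl

  zigzag-oneOf-counts : tally 10 zigzagRules (siteAt 0F false) (siteAt 5F false) (siteAt 5F true)
                      (tuples 4 oneOf) ≡ just (12 , 13)
  zigzag-oneOf-counts = refl

opaque
  zigzag-linear : Linear zigzagNet
  zigzag-linear = from-yes (linear? zigzagNet)

∑-withFixed : (l : List Letter) (f : Vec Letter 11 → ℕ) →
              ∑ (words (replicate 4 l Vec.++ replicate 7 both)) f ≡ ∑ (tuples 4 l) (f ∘ withFixed)
∑-withFixed l f = trans (∑-words-++ (replicate 4 l) (replicate 7 both))
                        (∑-cong (tuples 4 l) (λ c → ∑-singleton (replicate 7 (true , true))))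

zigzagCore : Bool → Vec Letter 11 → Vec Bool 6 → ℕ
zigzagCore i c v = ind (net? zigzagNet (siteAt 0F false) (siteAt 5F i) c v)

zigzag-less : ∑ (tuples 4 four) (λ c → ∑ (tuples 6 two) (zigzagCore false (withFixed c))) <
              ∑ (tuples 4 four) (λ c → ∑ (tuples 6 two) (zigzagCore true (withFixed c)))
zigzag-less = subst₂ _<_ (∑-withFixed four (λ c → ∑ (tuples 6 two) (zigzagCore false c)))
                         (∑-withFixed four (λ c → ∑ (tuples 6 two) (zigzagCore true c)))
  (net-less zigzagNet zigzag-linear (replicate 4 four Vec.++ replicate 7 both) symmetric
    (subst₂ _<_ (sym (∑-withFixed four (λ c → zigzagCore false c (replicate 6 false))))
                (sym (∑-withFixed four (λ c → zigzagCore true c (replicate 6 false))))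
      (<-tally (tally-sound 10 zigzagRules (siteAt 0F false) (siteAt 5F false) (siteAt 5F true)
                      (tuples 4 four) zigzag-counts)
               (n<1+n 160))))
  where
  symmetric : ∀ e → Symmetric (lookup (replicate 4 four Vec.++ replicate 7 both) e)
  symmetric e rewrite Vecₚ.lookup-splitAt 4 (replicate 4 four) (replicate 7 both) e with splitAt 4 e
  ... | inj₁ x = subst Symmetric (sym (Vecₚ.lookup-replicate x four)) four-symmetric
  ... | inj₂ x = subst Symmetric (sym (Vecₚ.lookup-replicate x both)) both-symmetric

zigzag-good : ∀ r k i (c : Vec Letter 4) (gs : Vec (Vec Letter k) (7 + (3 * r + 3 * r)))
              (v : Vec Bool 6) (ws : Vec (Vec Bool (suc r)) 3) →
              every (some bothOpen) gs ∧ every (some id) ws ≡ true →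
              ind (di? (zigzagArcs r k) (0F , false) (5F , i) (unzip (c Vec.++ Vec.concat gs) , v Vec.++ Vec.concat ws)) ≡
              zigzagCore i (withFixed c) v
zigzag-good r k i c gs v ws e =
  ind-⇔ (Digraphs.di-reach randomArcs fixedArcs r k c gs v ws (proj₁ g) (λ b → bothOpen-true (proj₂ g b)) (proj₁ j) (proj₂ j))
        (di? (zigzagArcs r k) (0F , false) (5F , i) _) (net? zigzagNet (siteAt 0F false) (siteAt 5F i) (withFixed c) v)
  where
  e′ : every (some bothOpen) gs ≡ true × every (some id) ws ≡ true
  e′ = ∧-true e
  g = pick bothOpen gs (proj₁ e′)
  j = pick id ws (proj₂ e′)

zigzagMultiDigraph : (r k : ℕ) → MultiDigraph (6 + 3 * suc r) (4 + (7 + (3 * r + 3 * r)) * k)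
zigzagMultiDigraph r k = record { arc = zigzagArcs r k }

-- There are two independent sources of failure, a link without a copy present on both levels and a
-- hub whose vertical edges, its own and those of its satellites, are all absent; the good fractions
-- multiply.
E7-less : ∀ r k → let #L = 7 + (3 * r + 3 * r) in
          4 ^ 4 * 2 ^ 6 * ((4 ^ k) ^ #L * (2 ^ suc r) ^ 3) <
          suc (4 ^ 4 * 2 ^ 6) * ((4 ^ k ∸ 3 ^ k) ^ #L * (2 ^ suc r ∸ 1 ^ suc r) ^ 3) →
          E7-PrLess (zigzagMultiDigraph r k) 0F 5F
E7-less r k few =
  prLess (λ _ → yes tt) (di? (zigzagArcs r k) (0F , false) (5F , false)) (di? (zigzagArcs r k) (0F , false) (5F , true))
    (subst₂ _<_ (total false) (total true)
      (thicken {P = P false} {Q = P true} (λ (gs , ws) → every (some bothOpen) gs ∧ every (some id) ws)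
        (λ (c , v) (gs , ws) → ind≤1 (di? (zigzagArcs r k) (0F , false) (5F , false)
                                          (unzip (c Vec.++ Vec.concat gs) , v Vec.++ Vec.concat ws)))
        (λ (c , v) (gs , ws) e → zigzag-good r k false c gs v ws e , zigzag-good r k true c gs v ws e)
        (subst₂ _<_ (sym (∑-× (tuples 4 four) (tuples 6 two))) (sym (∑-× (tuples 4 four) (tuples 6 two))) zigzag-less)
        (subst₂ _<_ (cong₂ _*_ (sym sizeC) (sym sizeW)) (cong₂ (λ x y → suc x * y) (sym sizeC) (sym goodW)) few)))
  where
  #L = 7 + (3 * r + 3 * r)
  #A = 4 + #L * k
  #V = 6 + 3 * suc r
  Gs : List (Vec (Vec Letter k) #L)
  Gs = tuples #L (tuples k four)
  Hs : List (Vec (Vec Bool (suc r)) 3)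
  Hs = tuples 3 (tuples (suc r) two)
  Cs : List (Vec Letter 4 × Vec Bool 6)
  Cs = cartesianProduct (tuples 4 four) (tuples 6 two)
  Ws : List (Vec (Vec Letter k) #L × Vec (Vec Bool (suc r)) 3)
  Ws = cartesianProduct Gs Hs
  count : Bool → EdgeSel #A #V → ℕ
  count i X = ind (di? (zigzagArcs r k) (0F , false) (5F , i) X)
  P : Bool → Vec Letter 4 × Vec Bool 6 → Vec (Vec Letter k) #L × Vec (Vec Bool (suc r)) 3 → ℕ
  P i (c , v) (gs , ws) = count i (unzip (c Vec.++ Vec.concat gs) , v Vec.++ Vec.concat ws)
  sizeC : size Cs ≡ 4 ^ 4 * 2 ^ 6
  sizeC = trans (size-× (tuples 4 four) (tuples 6 two))
                (cong₂ _*_ (trans (size-tuples 4 four) (cong (_^ 4) size-four))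
                           (trans (size-tuples 6 two) (cong (_^ 6) size-two)))
  sizeW : size Ws ≡ (4 ^ k) ^ #L * (2 ^ suc r) ^ 3
  sizeW = trans (size-× Gs Hs)
    (cong₂ _*_ (trans (size-groups #L k four) (cong (λ z → (z ^ k) ^ #L) size-four))
               (trans (size-groups 3 (suc r) two) (cong (λ z → (z ^ suc r) ^ 3) size-two)))
  goodW : ∑ Ws (λ (gs , ws) → bit (every (some bothOpen) gs ∧ every (some id) ws)) ≡
          (4 ^ k ∸ 3 ^ k) ^ #L * (2 ^ suc r ∸ 1 ^ suc r) ^ 3
  goodW = trans (∑-∧ (every (some bothOpen)) (every (some id)) Gs Hs)
    (cong₂ _*_ (trans (∑-groups bothOpen #L k four) (cong₂ (λ x y → (x ^ k ∸ y ^ k) ^ #L) size-four misses-four))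
               (trans (∑-groups id 3 (suc r) two) (cong₂ (λ x y → (x ^ suc r ∸ y ^ suc r) ^ 3) size-two misses-two)))
  total : ∀ i → ∑ Cs (λ x → ∑ Ws (P i x)) ≡ ∑ (allEdgeSels #A #V) (λ X → 1 * count i X)
  total i = sym (begin
    ∑ (allEdgeSels #A #V) (λ X → 1 * count i X)
      ≡⟨ ∑-cong (allEdgeSels #A #V) (λ X → *-identityˡ (count i X)) ⟩
    ∑ (allEdgeSels #A #V) (count i)
      ≡⟨ ∑-edgeSels #A #V ⟩
    ∑ (tuples #A four) (λ w → ∑ (tuples #V two) (λ v → count i (unzip w , v)))
      ≡⟨ trans (∑-tuples-+ 4) (∑-cong (tuples 4 four) (λ c → ∑-tuples-* {n = k} #L)) ⟩
    ∑ (tuples 4 four) (λ c → ∑ Gs (λ gs → ∑ (tuples #V two) (λ v → count i (unzip (c Vec.++ Vec.concat gs) , v))))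
      -- The vertical edges at the sites belong to the core but are enumerated after the links, so
      -- their sum has to be moved forward.
      ≡⟨ ∑-cong (tuples 4 four) (λ c → trans
           (∑-cong Gs (λ gs → trans (∑-tuples-+ 6) (∑-cong (tuples 6 two) (λ v → ∑-tuples-* {n = suc r} 3))))
           (trans (∑-comm Gs (tuples 6 two)) (∑-cong (tuples 6 two) (λ v → sym (∑-× Gs Hs))))) ⟩
    ∑ (tuples 4 four) (λ c → ∑ (tuples 6 two) (λ v → ∑ Ws (P i (c , v))))
      ≡⟨ sym (∑-× (tuples 4 four) (tuples 6 two)) ⟩
    ∑ Cs (λ x → ∑ Ws (P i x))
      ∎)
    where open ≡-Reasoning

-- Packing the example while `r` and `k` are variables leaves its sizes implicit; for the values
-- chosen below they are 57 vertices and 5360 arcs.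
E7-example : ∀ r k → let #L = 7 + (3 * r + 3 * r) in
             4 ^ 4 * 2 ^ 6 * ((4 ^ k) ^ #L * (2 ^ suc r) ^ 3) <
             suc (4 ^ 4 * 2 ^ 6) * ((4 ^ k ∸ 3 ^ k) ^ #L * (2 ^ suc r ∸ 1 ^ suc r) ^ 3) →
             Σ ℕ λ n → Σ ℕ λ m → Σ (MultiDigraph n m) λ D → Σ (Fin n) λ u → Σ (Fin n) λ v → E7-PrLess D u v
E7-example r k few = _ , _ , zigzagMultiDigraph r k , 0F , 5F , E7-less r k few

-- With `r = 0` and `k = 1` there are no satellites and every arc occurs once, so the multidigraph
-- is a simple digraph.
zigzagDigraph : Digraph 9 11
zigzagDigraph = record
  { arc      = zigzagArcs 0 1
  ; loopless = from-yes (Finₚ.all? λ e → ¬? (proj₁ (zigzagArcs 0 1 e) Finₚ.≟ proj₂ (zigzagArcs 0 1 e)))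
  ; distinct = from-yes (Finₚ.all? λ e → Finₚ.all? λ f →
                 ×-≡-dec Finₚ._≟_ Finₚ._≟_ (zigzagArcs 0 1 e) (zigzagArcs 0 1 f) →-dec (e Finₚ.≟ f))
  }

E6-less : E6-PrLess zigzagDigraph (hubsOnly 6) (replicate 4 false Vec.++ replicate 7 true) 0F 5F
E6-less =
  prLess valid? (di? (zigzagArcs 0 1) (0F , false) (5F , false)) (di? (zigzagArcs 0 1) (0F , false) (5F , true))
    (subst₂ _<_ (sym (total false)) (sym (total true))
      (<-tally (tally-sound 10 zigzagRules (siteAt 0F false) (siteAt 5F false) (siteAt 5F true)
                      (tuples 4 oneOf) zigzag-oneOf-counts)
               (n<1+n 12)))
  where
  T : Vec Bool 9
  T = hubsOnly 6
  F : Vec Bool 11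
  F = replicate 4 false Vec.++ replicate 7 true
  valid? : ∀ X → Dec (E6-Valid T F X)
  valid? X = fitting? F (proj₁ X) ×-dec Vecₚ.≡-dec Boolₚ._≟_ (verts X) T
  total : ∀ i → ∑ (allEdgeSels 11 9) (λ X → ind (valid? X) * ind (di? (zigzagArcs 0 1) (0F , false) (5F , i) X)) ≡
                ∑ (tuples 4 oneOf) (λ c → zigzagCore i (withFixed c) (replicate 6 false))
  total i = trans
    (∑-admissible F T valid? (λ X → mk⇔ id id) (λ X → ind (di? (zigzagArcs 0 1) (0F , false) (5F , i) X)))
    (trans (∑-withFixed oneOf (λ w → ind (di? (zigzagArcs 0 1) (0F , false) (5F , i) (unzip w , T))))
           (∑-cong (tuples 4 oneOf) (λ c → zigzag-good 0 1 i c (replicate 7 ((true , true) ∷ [])) (replicate 6 false)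
                                                       (replicate 3 (true ∷ [])) refl)))

theorem1p1 : (Σ ℕ λ n → Σ (SimpleGraph n) λ G → Σ (Fin n) λ u → Σ (Fin n) λ v →
    E1-PrLess G u v) ×
    (Σ ℕ λ n → Σ (SimpleGraph n) λ G → Σ (Vec Bool n) λ T →
    Σ (Fin n) λ u → Σ (Fin n) λ v → E2-PrLess G T u v) ×
    (Σ ℕ λ n → Σ ℕ λ m → Σ (Hypergraph n m) λ H → Σ (Vec Bool n) λ T →
    Σ (Fin n) λ u → Σ (Fin n) λ v → E4-PrLess H T u v) ×
    (Σ ℕ λ n → Σ ℕ λ m → Σ (Hypergraph n m) λ H →
    Σ (Fin n) λ u → Σ (Fin n) λ v → E5-PrLess H u v) ×
    (Σ ℕ λ n → Σ ℕ λ m → Σ (Digraph n m) λ D → Σ (Vec Bool n) λ T →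
    Σ (Vec Bool m) λ F → Σ (Fin n) λ u → Σ (Fin n) λ v → E6-PrLess D T F u v) ×
    (Σ ℕ λ n → Σ ℕ λ m → Σ (MultiDigraph n m) λ D →
    Σ (Fin n) λ u → Σ (Fin n) λ v → E7-PrLess D u v)
theorem1p1 =
  -- 33 is the least `r` for which the failure probability, about 3·(3/4)^r, is below 1/(4⁶ + 1);
  -- there are 6 + 3·33 vertices.
  (105 , siteGraph 33 , 0F , 5F , E1-less 33 (<ᵇ⇒< _ _ tt)) ,
  (9 , siteGraph 1 , hubsOnly 6 , 0F , 5F , E2-less) ,
  (10 , 6 , pathHypergraph 1 , hubsOnly 7 , 0F , 6F , E4-less) ,
  -- Here about 3/2^r must be below 1/(4⁶·2⁷ + 1), and 21 is the least such `r`.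
  (70 , 6 , pathHypergraph 21 , 0F , 6F , E5-less 21 (<ᵇ⇒< _ _ tt)) ,
  (9 , 11 , zigzagDigraph , hubsOnly 6 , replicate 4 false Vec.++ replicate 7 true , 0F , 5F , E6-less) ,
  -- The hubs fail with probability about 3/2¹⁷ and the 103 links with about 103·(3/4)⁵², together
  -- below 1/(4⁴·2⁶ + 1).
  E7-example 16 52 (<ᵇ⇒< _ _ tt)
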